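{- There exists an FPT algorithm for the Superset-Simultaneous-Dipaths problem parameterized by the number $\ell$ of multi-colored arcs, and an FPT algorithm for the Superset-Simultaneous-Paths problem parameterized by the number $\ell$ of multi-colored edges. In each case the algorithm takes $k\cdot 2^{\ell}$ executions of a shortest path algorithm in some subgraphs of the input graph with nonnegative cost function.
   Context: Superset-Simultaneous-Dipaths: the input is a positive integer $k$, a digraph $D=(V,A)$ with $A=A_1\cup\cdots\cup A_k$ (the color classes $A_i$ are not necessarily disjoint), two distinct vertices $s,t\in V$, and a conservative cost function $c\colon A\to\mathbb{R}$ (no directed cycle of negative total cost). The task is to find $A'\subseteq A$ of minimum cost $\sum_{a\in A'}c(a)$ such that $A'\cap A_i$ contains (the arc set of) an $s$-$t$ dipath for all $i\in\{1,\ldots,k\}$, or to determine that no such $A'$ exists. Superset-Simultaneous-Paths: the input is a positive integer $k$, an undirected graph $G=(V,E)$ with $E=E_1\cup\cdots\cup E_k$ (the $E_i$ not necessarily disjoint), two distinct vertices $s,t\in V$, and a nonnegative cost function $c\colon E\to\mathbb{R}_+$. The task is to find $E'\subseteq E$ of minimum cost such that $E'\cap E_i$ contains (the edge set of) an $s$-$t$ path for all $i\in\{1,\ldots,k\}$, or to determine that no such $E'$ exists. An arc (edge) is multi-colored if it belongs to at least two of the color classes. Graphs and digraphs are finite and may have parallel edges or arcs. An FPT algorithm with parameter $\ell$ is an algorithm with running time bounded by $f(\ell)\cdot\mathrm{poly}(N)$, where $N$ is the size of the input and $f\colon\mathbb{Z}_+\to\mathbb{Z}_+$ is an arbitrary computable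 function ($\mathbb{Z}_+$ is the set of nonnegative integers). -}

module Defs where

open import Algebra.Structures using (IsAbelianGroup)
open import Data.Bool.Base using (Bool; true; false; if_then_else_)
open import Data.Fin.Base using (Fin; toℕ)
open import Data.Fin.Subset using (Subset; _∈_; _⊆_; _∩_; ⁅_⁆; ⋃; ∣_∣)
open import Data.List.Base as List using (List; []; _∷_; _++_)
open import Data.List.Relation.Binary.Sublist.Propositional using () renaming (_⊆_ to _⊑_)
open import Data.List.Relation.Unary.All using (All)
open import Data.List.Relation.Unary.Unique.Propositional using (Unique)
open import Data.Nat.Base as ℕ using (ℕ; zero; suc; _*_; _^_)
import Data.Nat.Properties as ℕ using (_≤?_)
open import Data.Product.Base using (_×_; _,_; ∃-syntax; Σ-syntax)
open import Data.Sum.Base using (_⊎_)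
open import Data.Vec.Base as Vec using (Vec; []; _∷_; lookup)
import Data.Empty.Polymorphic as Poly
import Data.Vec.Functional as Vector
open import Level using (Level; _⊔_) renaming (suc to lsuc)
open import Relation.Binary.Core using (Rel)
open import Relation.Binary.PropositionalEquality.Core using (_≡_; _≢_)
open import Relation.Binary.Structures using (IsDecTotalOrder)
open import Relation.Nullary.Decidable.Core using (does)
open import Relation.Nullary.Negation.Core using (¬_)

-- The domain of the costs.  Since there is no type of real numbers, the
-- additive ordered group of the reals is replaced by an arbitrary totally
-- ordered abelian group; the order is decidable because programs compare
-- costs.
record OrderedAbelianGroup (a ℓ₁ ℓ₂ : Level) : Set (lsuc (a ⊔ ℓ₁ ⊔ ℓ₂)) where
  infix  4 _≈_ _≤_
  infixl 6 _+_
  field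
    Carrier         : Set a
    _≈_             : Rel Carrier ℓ₁
    _≤_             : Rel Carrier ℓ₂
    _+_             : Carrier → Carrier → Carrier
    0#              : Carrier
    -_              : Carrier → Carrier
    isAbelianGroup  : IsAbelianGroup _≈_ _+_ 0# -_
    isDecTotalOrder : IsDecTotalOrder _≈_ _≤_
    +-monoˡ-≤       : ∀ z {x y} → x ≤ y → x + z ≤ y + z

  open IsDecTotalOrder isDecTotalOrder public using (_≤?_)

-- The model of computation is a first-order functional language with
-- general recursion over binary trees whose leaves are nil or a cost, in the
-- style of Jones' languages F and WHILE.  Costs are only added, negated and
-- compared, as in the additive real RAM; naturals are not primitive.
-- Programs do not depend on the cost domain.

data Op₁ : Set where
  hd tl neg : Op₁

data Op₂ : Set where
  cons add leq : Op₂

-- `Exp F Γ`: expressions with F (unary, mutually recursive) functions and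
-- Γ variables in scope.  `ask` runs the external subroutine.
data Exp (F : ℕ) : ℕ → Set where
  var          : ∀ {Γ} → Fin Γ → Exp F Γ
  nil          : ∀ {Γ} → Exp F Γ
  zero#        : ∀ {Γ} → Exp F Γ
  op₁          : ∀ {Γ} → Op₁ → Exp F Γ → Exp F Γ
  op₂          : ∀ {Γ} → Op₂ → Exp F Γ → Exp F Γ → Exp F Γ
  ifnil_⟨_∣_⟩  : ∀ {Γ} → Exp F Γ → Exp F Γ → Exp F Γ → Exp F Γ
  let'         : ∀ {Γ} → Exp F Γ → Exp F (suc Γ) → Exp F Γ
  call         : ∀ {Γ} → Fin F → Exp F Γ → Exp F Γ
  ask          : ∀ {Γ} → Exp F Γ → Exp F Γ

record Program : Set where
  field
    functions : ℕ
    body      : Vec (Exp functions 1) functions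
    main      : Exp functions 1

data Orientation : Set where
  directed undirected : Orientation

-- An arc (edge) is a position in the vector of end pairs, so that parallel
-- arcs are distinct.
Ends : ℕ → ℕ → Set
Ends n m = Vec (Fin n × Fin n) m

-- In the undirected case the order within the pair is immaterial.
Traverses : Orientation → ∀ {n} → Fin n × Fin n → Fin n → Fin n → Set
Traverses directed   e u v = e ≡ (u , v)
Traverses undirected e u v = e ≡ (u , v) ⊎ e ≡ (v , u)

data Walk (o : Orientation) {n m : ℕ} (E : Ends n m) : Fin n → Fin n → Set where
  []   : ∀ {u} → Walk o E u u
  step : ∀ {u v w} (a : Fin m) → Traverses o (lookup E a) u v →
         Walk o E v w → Walk o E u w

module _ {o : Orientation} {n m : ℕ} {E : Ends n m} where

  arcs : ∀ {u v} → Walk o E u v → List (Fin m)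
  arcs []           = []
  arcs (step a _ W) = a ∷ arcs W

  arcSet : ∀ {u v} → Walk o E u v → Subset m
  arcSet W = ⋃ (List.map ⁅_⁆ (arcs W))

  -- The vertices of a walk, except its final one.
  tails : ∀ {u v} → Walk o E u v → List (Fin n)
  tails []                   = []
  tails (step {u = u} _ _ W) = u ∷ tails W

  IsPath : ∀ {u v} → Walk o E u v → Set
  IsPath {v = v} W = Unique (tails W ++ v ∷ [])

  -- Used for directed graphs only.
  IsCycle : ∀ {u} → Walk o E u u → Set
  IsCycle W = arcs W ≢ [] × Unique (tails W)

module Costs {a ℓ₁ ℓ₂ : Level} (K : OrderedAbelianGroup a ℓ₁ ℓ₂) where

  open OrderedAbelianGroup K

  infixr 5 _∙_

  data Value : Set a where
    nil : Value
    num : Carrier → Value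
    _∙_ : Value → Value → Value

  size : Value → ℕ
  size nil     = 1
  size (num _) = 1
  size (v ∙ w) = suc (size v ℕ.+ size w)

  bool : Bool → Value
  bool false = nil
  bool true  = nil ∙ nil

  -- Ill-typed applications yield nil.
  ⟦_⟧₁ : Op₁ → Value → Value
  ⟦ hd  ⟧₁ (v ∙ _) = v
  ⟦ tl  ⟧₁ (_ ∙ w) = w
  ⟦ neg ⟧₁ (num x) = num (- x)
  ⟦ _   ⟧₁ _       = nil

  ⟦_⟧₂ : Op₂ → Value → Value → Value
  ⟦ cons ⟧₂ v       w       = v ∙ w
  ⟦ add  ⟧₂ (num x) (num y) = num (x + y)
  ⟦ leq  ⟧₂ (num x) (num y) = bool (does (x ≤? y))
  ⟦ _    ⟧₂ _       _       = nil

  -- `S v w t`: on input v the subroutine returns w after t steps.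
  Subroutine : Set (lsuc a)
  Subroutine = Value → Value → ℕ → Set a

  none : Subroutine
  none _ _ _ = Poly.⊥

  -- `Eval S fs ρ e v t qs`: in the environment ρ, with function bodies fs and
  -- subroutine S, the expression e evaluates to v in t steps (including those
  -- taken by S), and qs lists the inputs of the executions of S.
  data Eval (S : Subroutine) {F : ℕ} (fs : Vec (Exp F 1) F) {Γ : ℕ} (ρ : Vec Value Γ) :
            Exp F Γ → Value → ℕ → List Value → Set a where
    var   : ∀ x → Eval S fs ρ (var x) (lookup ρ x) 1 []
    nil   : Eval S fs ρ nil nil 1 []
    zero# : Eval S fs ρ zero# (num 0#) 1 []
    op₁   : ∀ ω {e v t qs} → Eval S fs ρ e v t qs →
            Eval S fs ρ (op₁ ω e) (⟦ ω ⟧₁ v) (1 ℕ.+ t) qs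
    op₂   : ∀ ω {e₁ e₂ v₁ v₂ t₁ t₂ qs₁ qs₂} →
            Eval S fs ρ e₁ v₁ t₁ qs₁ → Eval S fs ρ e₂ v₂ t₂ qs₂ →
            Eval S fs ρ (op₂ ω e₁ e₂) (⟦ ω ⟧₂ v₁ v₂) (1 ℕ.+ t₁ ℕ.+ t₂) (qs₁ ++ qs₂)
    if-nil : ∀ {e e₁ e₂ v₁ t t₁ qs qs₁} →
             Eval S fs ρ e nil t qs → Eval S fs ρ e₁ v₁ t₁ qs₁ →
             Eval S fs ρ (ifnil e ⟨ e₁ ∣ e₂ ⟩) v₁ (1 ℕ.+ t ℕ.+ t₁) (qs ++ qs₁)
    if-non : ∀ {e e₁ e₂ v v₂ t t₂ qs qs₂} →
             Eval S fs ρ e v t qs → v ≢ nil → Eval S fs ρ e₂ v₂ t₂ qs₂ →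
             Eval S fs ρ (ifnil e ⟨ e₁ ∣ e₂ ⟩) v₂ (1 ℕ.+ t ℕ.+ t₂) (qs ++ qs₂)
    let'  : ∀ {e₁ e₂ v₁ v₂ t₁ t₂ qs₁ qs₂} →
            Eval S fs ρ e₁ v₁ t₁ qs₁ → Eval S fs (v₁ ∷ ρ) e₂ v₂ t₂ qs₂ →
            Eval S fs ρ (let' e₁ e₂) v₂ (1 ℕ.+ t₁ ℕ.+ t₂) (qs₁ ++ qs₂)
    call  : ∀ f {e v w t t′ qs qs′} →
            Eval S fs ρ e v t qs → Eval S fs (v ∷ []) (lookup fs f) w t′ qs′ →
            Eval S fs ρ (call f e) w (1 ℕ.+ t ℕ.+ t′) (qs ++ qs′)
    ask   : ∀ {e v w t t′ qs} →
            Eval S fs ρ e v t qs → S v w t′ →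
            Eval S fs ρ (ask e) w (1 ℕ.+ t ℕ.+ t′) (qs ++ v ∷ [])

  RunWith : Subroutine → Program → Value → Value → ℕ → List Value → Set a
  RunWith S P v w t qs = Eval S (Program.body P) (v ∷ []) (Program.main P) w t qs

  Run : Program → Subroutine
  Run P v w t = RunWith none P v w t []

  vec : ∀ {b m} {A : Set b} → (A → Value) → Vec A m → Value
  vec f []       = nil
  vec f (x ∷ xs) = f x ∙ vec f xs

  nat : ℕ → Value
  nat zero    = nil
  nat (suc n) = nil ∙ nat n

  fin : ∀ {n} → Fin n → Value
  fin i = nat (toℕ i)

  subset : ∀ {m} → Subset m → Value
  subset = vec bool

  ends : ∀ {n m} → Ends n m → Value
  ends = vec λ (u , v) → fin u ∙ fin v

  Computable : (ℕ → ℕ) → Set a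
  Computable f = ∃[ P ] ∀ n → ∃[ t ] Run P (nat n) (nat (f n)) t

  record Network : Set a where
    constructor network
    field
      {n m} : ℕ
      E     : Ends n m
      cost  : Vec Carrier m
      s t   : Fin n

  ⌜_⌝ : Network → Value
  ⌜ N ⌝ = nat n ∙ ends E ∙ vec num cost ∙ fin s ∙ fin t
    where open Network N

  NonNegative : ∀ {m} → Vec Carrier m → Set ℓ₂
  NonNegative c = ∀ i → 0# ≤ lookup c i

  walkCost : ∀ {o n m} {E : Ends n m} {u v} → Vec Carrier m → Walk o E u v → Carrier
  walkCost c W = List.foldr _+_ 0# (List.map (lookup c) (arcs W))

  setCost : ∀ {m} → Vec Carrier m → Subset m → Carrier
  setCost c B = Vector.foldr _+_ 0# λ i → if lookup B i then lookup c i else 0#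

  Conservative : ∀ {n m} → Ends n m → Vec Carrier m → Set ℓ₂
  Conservative E c = ∀ {u} (W : Walk directed E u u) → IsCycle W → 0# ≤ walkCost c W

  module _ (o : Orientation) (N : Network) where

    open Network N

    IsShortestPath : Walk o E s t → Set ℓ₂
    IsShortestPath W =
      IsPath W × (∀ (W′ : Walk o E s t) → IsPath W′ → walkCost cost W ≤ walkCost cost W′)

    -- The output is the arc set of a shortest path, or nil if there is no path.
    SolvesShortestPath : Value → Set (a ⊔ ℓ₂)
    SolvesShortestPath v =
        (∃[ W ] IsShortestPath W × v ≡ nil ∙ subset (arcSet W))
      ⊎ ((¬ (Σ[ W ∈ Walk o E s t ] IsPath W)) × v ≡ nil)

  -- A polynomial-time algorithm; nothing is required of it on networks with
  -- negative costs.
  ShortestPathAlgorithm : Orientation → Program → Set (a ⊔ ℓ₂)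
  ShortestPathAlgorithm o S =
    ∃[ c ] ∃[ d ] ∀ (N : Network) → NonNegative (Network.cost N) →
      ∃[ v ] ∃[ t ] Run S ⌜ N ⌝ v t × SolvesShortestPath o N v
                  × t ℕ.≤ c * size ⌜ N ⌝ ^ d

  CostCondition : Orientation → ∀ {n m} → Ends n m → Vec Carrier m → Set ℓ₂
  CostCondition directed   E c = Conservative E c
  CostCondition undirected E c = NonNegative c

  -- An input of Superset-Simultaneous-Dipaths (directed) or of
  -- Superset-Simultaneous-Paths (undirected).
  record Instance (o : Orientation) : Set (a ⊔ ℓ₂) where
    field
      net : Network
    open Network net public
    field
      {k}     : ℕ
      k>0     : 0 ℕ.< k
      classes : Vec (Subset m) k
      covered : ∀ e → ∃[ i ] e ∈ lookup classes i
      s≢t     : s ≢ t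
      cost-ok : CostCondition o E cost

  module _ {o : Orientation} (I : Instance o) where

    open Instance I

    encode : Value
    encode = ⌜ net ⌝ ∙ vec subset classes

    inputSize : ℕ
    inputSize = size encode

    coloursOf : Fin m → Subset k
    coloursOf e = Vec.map (λ C → lookup C e) classes

    multicoloured : Subset m
    multicoloured = Vec.tabulate λ e → does (2 ℕ.≤? ∣ coloursOf e ∣)

    Feasible : Subset m → Set
    Feasible B = ∀ i → Σ[ W ∈ Walk o E s t ] IsPath W × arcSet W ⊆ B ∩ lookup classes i

    Optimal : Subset m → Set ℓ₂
    Optimal B = Feasible B × (∀ B′ → Feasible B′ → setCost cost B ≤ setCost cost B′)

    Solves : Value → Set (a ⊔ ℓ₂)
    Solves v = (∃[ B ] Optimal B × v ≡ nil ∙ subset B)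
             ⊎ ((¬ (∃[ B ] Feasible B)) × v ≡ nil)

    -- v encodes a (spanning) subgraph of the input graph with nonnegative
    -- costs, which need not be the original ones, and two terminals.
    SubgraphQuery : Value → Set (a ⊔ ℓ₂)
    SubgraphQuery v =
      ∃[ m′ ] Σ[ E′ ∈ Ends n m′ ] Σ[ c′ ∈ Vec Carrier m′ ] ∃[ s′ ] ∃[ t′ ]
        Vec.toList E′ ⊑ Vec.toList E × NonNegative c′ × v ≡ ⌜ network E′ c′ s′ t′ ⌝

  -- Q with subroutine S solves the problem in time f(ℓ)·poly(N) (including
  -- the time spent in S), executing S exactly k·2^ℓ times.
  FPTAlgorithm : Orientation → Program → Program → Set (a ⊔ ℓ₂)
  FPTAlgorithm o Q S =
    ∃[ f ] Computable f × (∃[ c ] ∃[ d ] ∀ (I : Instance o) →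
      let ℓ = ∣ multicoloured I ∣ in
      ∃[ v ] ∃[ t ] ∃[ qs ]
          RunWith (Run S) Q (encode I) v t qs
        × Solves I v
        × t ℕ.≤ f ℓ * (c * inputSize I ^ d)
        × List.length qs ≡ Instance.k I * 2 ^ ℓ
        × All (SubgraphQuery I) qs)

{-# OPTIONS --safe #-}
-- Arcs of negative cost belong to a superset for free, so a solution may be
-- assumed to contain them all, and the positive parts of the costs remain to be
-- minimised.  Once the set F of the multicoloured arcs to be bought is fixed,
-- every other arc that may be used lies in a single class, and the classes
-- decouple: for each class take a shortest s-t path in the class without the
-- multicoloured arcs outside F, where the arcs of F cost nothing.  The best of
-- the 2^ℓ unions of k such paths (together with the negative arcs) is optimal.
--
-- That shortest path algorithms exist is shown by the method of Bellman and
-- Ford, run backwards from t so that walks are extended at their first vertex.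

module Submission where

open import Defs
open import Algebra.Bundles using (AbelianGroup)
open import Data.Bool.Base using (Bool; true; false; T; _∧_; _∨_; not; if_then_else_)
open import Data.Fin using (#_)
open import Data.Fin.Base using (Fin; zero; suc; toℕ)
open import Data.Fin.Properties using (_≟_; injective⇒≤)
open import Data.Fin.Subset using (Subset; ∣_∣; _∪_; ⁅_⁆; ⊥; _∈_; _∩_; _⊆_; ⋃)
open import Data.Fin.Subset.Properties
  using (x∈⁅x⁆; x≢y⇒x∉⁅y⁆; x∈⁅y⁆⇒x≡y; x∈p∪q⁺; x∈p∪q⁻; x∈p∩q⁺; x∈p∩q⁻; ⊆-antisym; ∉⊥; _∈?_; p∩q⊆p;
         p∩q⊆q; ∣p∣≤∣x∷p∣)
open import Data.List.Base as List using (List; []; _∷_; _++_; length)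
import Data.List.Membership.Propositional as List
open import Data.List.Membership.Propositional.Properties using (∈-lookup; ∈-map⁺; ∈-map⁻)
open import Data.List.Properties using (length-++; ++-identityʳ)
open import Data.List.Relation.Binary.Sublist.Propositional
  using ([]; _∷_; _∷ʳ_) renaming (_⊆_ to _⊑_)
open import Data.List.Relation.Unary.All as All using (All; []; _∷_)
open import Data.List.Relation.Unary.All.Properties using (¬Any⇒All¬; All¬⇒¬Any; ++⁺)
open import Data.List.Relation.Unary.AllPairs using ([]; _∷_)
open import Data.List.Relation.Unary.Any using (here; there)
open import Data.List.Relation.Unary.Unique.Propositional using (Unique)
open import Data.Maybe.Base as Maybe using (Maybe; just; nothing)
open import Data.Nat.Base as ℕ using (ℕ; zero; suc; _*_; _^_; z≤n; s≤s)
import Data.Nat.ListAction as ℕ using (sum)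
import Data.Nat.ListAction.Properties as ℕ using (sum-++)
import Data.Nat.Properties as ℕ
open import Data.Nat.Solver using (module +-*-Solver)
open import Data.Product.Base using (_×_; _,_; ∃-syntax; Σ-syntax; proj₁; proj₂)
open import Data.Sum.Base as Sum using (_⊎_; inj₁; inj₂)
open import Data.Vec.Base as Vec using (Vec; []; _∷_; lookup; here; there; _[_]≔_)
open import Data.Vec.Properties
  using (lookup-zipWith; lookup-replicate; []=⇒lookup; lookup⇒[]=; lookup-map; lookup∘updateAt;
         lookup∘updateAt′; lookup∘tabulate; tabulate∘lookup; tabulate-cong)
open import Function.Base using (_∘_)
open import Level using (Level; _⊔_)
open import Relation.Binary.Bundles using (Poset)
open import Relation.Binary.PropositionalEquality
  using (_≡_; _≢_; refl; sym; trans; cong; cong₂; subst; module ≡-Reasoning)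
open import Relation.Binary.Structures using (IsDecTotalOrder)
open import Relation.Nullary.Decidable.Core using (does; yes; no)
open import Relation.Nullary.Negation.Core using (¬_; contradiction)

-- Why the classes decouple: fix the set F of multicoloured arcs to be bought. If two classes use
-- the same arc, it is multicoloured, hence in F and free. So the charges of paths chosen one per
-- class add up to the charge of their union. True costs and charges differ by a constant that
-- depends on F alone, with errors in the favourable direction only: the computed set may leave out
-- arcs of F, while a rival that contains F may leave out negative arcs. Hence the set computed for
-- F is feasible and no dearer than any solution whose multicoloured arcs are exactly those of F.
-- Every solution has such an F, so the cheapest computed set is optimal. The number of queries is
-- exact because the search is never cut short: both branches on each multicoloured arc are run, and
-- each class is queried even if another one has already failed. Running times are bounded by
-- numeral multiples of a unit `suc u`, so that the accounting within one function body is settled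
-- by computation; a loop is absorbed by passing to a larger unit.

infixr 5 _⊙_
pattern _⊙_ e₁ e₂ = op₂ cons e₁ e₂
pattern true#     = nil ⊙ nil
pattern x₀        = var zero
pattern x₁        = var (suc zero)
pattern x₂        = var (suc (suc zero))
pattern x₃        = var (suc (suc (suc zero)))
pattern x₄        = var (suc (suc (suc (suc zero))))

-- The programs, written over one common library of functions

hd# tl# : ∀ {F Γ} → Exp F Γ → Exp F Γ
hd# = op₁ hd
tl# = op₁ tl

lookup# update# blank# relax# relaxEdge# relaxAll# rounds# : Fin 21
lookup#    = # 0
update#    = # 1
blank#     = # 2
relax#     = # 3
relaxEdge# = # 4
relaxAll#  = # 5
rounds#    = # 6

bump# counts# collect# single# pos# negs# meet# compress# expand# setCost# gather# solve# : Fin 21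
bump#      = # 7
counts#    = # 8
collect#   = # 9
single#    = # 10
pos#       = # 11
negs#      = # 12
meet#      = # 13
compress#  = # 14
expand#    = # 15
setCost#   = # 16
gather#    = # 17
solve#     = # 18

double# pow# : Fin 21
double#    = # 19
pow#       = # 20

relaxEdge : Orientation → Exp 21 1
relaxEdge directed   = call relax# x₀
relaxEdge undirected =
  call relax# ((tl# (hd# x₀) ⊙ hd# (hd# x₀)) ⊙ hd# (tl# x₀) ⊙ call relax# x₀)

-- In scope: answer to the query, mask of the query, result for the other classes.
gatherResult : Exp 21 4
gatherResult =
  ifnil x₂ ⟨ nil ∣ ifnil x₀ ⟨ nil ∣ nil ⊙ call expand# (x₁ ⊙ tl# x₀ ⊙ tl# x₂) ⟩ ⟩

-- Each function has a single argument, whose layout is given in the comment.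
library : Orientation → Vec (Exp 21 1) 21
library o =
    -- lookup: i ∙ list
    ifnil hd# x₀
      ⟨ hd# (tl# x₀)
      ∣ call lookup# (tl# (hd# x₀) ⊙ tl# (tl# x₀)) ⟩
    -- update: i ∙ list ∙ new entry
  ∷ ifnil hd# x₀
      ⟨ tl# (tl# x₀) ⊙ tl# (hd# (tl# x₀))
      ∣ hd# (hd# (tl# x₀)) ⊙
        call update# (tl# (hd# x₀) ⊙ tl# (hd# (tl# x₀)) ⊙ tl# (tl# x₀)) ⟩
    -- blank: list
  ∷ ifnil x₀ ⟨ nil ∣ nil ⊙ call blank# (tl# x₀) ⟩
    -- relax: (u ∙ v) ∙ (arc ∙ cost) ∙ labels
  ∷ let' (call lookup# (tl# (hd# x₀) ⊙ tl# (tl# x₀)))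
    (ifnil x₀ ⟨ tl# (tl# x₁) ∣
      let' (op₂ add (tl# (hd# (tl# x₁))) (hd# x₀) ⊙
            call update# (hd# (hd# (tl# x₁)) ⊙ tl# x₀ ⊙ true#))
      (let' (call lookup# (hd# (hd# x₂) ⊙ tl# (tl# x₂)))
      -- The new labels are computed before it is known whether they are wanted, so that the
      -- remaining case distinction contains no call.
      (let' (call update# (hd# (hd# x₃) ⊙ tl# (tl# x₃) ⊙ x₁))
      (ifnil x₁ ⟨ x₀ ∣
       ifnil op₂ leq (hd# x₁) (hd# x₂) ⟨ x₀ ∣ tl# (tl# x₄) ⟩ ⟩))) ⟩)
    -- relaxEdge: (u ∙ v) ∙ (arc ∙ cost) ∙ labels
  ∷ relaxEdge o
    -- relaxAll: ends ∙ costs ∙ number of the first arc ∙ labels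
  ∷ ifnil hd# x₀
      ⟨ tl# (tl# (tl# x₀))
      ∣ call relaxAll# (tl# (hd# x₀) ⊙ tl# (hd# (tl# x₀)) ⊙ (nil ⊙ hd# (tl# (tl# x₀))) ⊙
          call relaxEdge# (hd# (hd# x₀) ⊙ (hd# (tl# (tl# x₀)) ⊙ hd# (hd# (tl# x₀))) ⊙
                           tl# (tl# (tl# x₀)))) ⟩
    -- rounds: number of rounds ∙ (ends ∙ costs) ∙ labels
  ∷ ifnil hd# x₀
      ⟨ tl# (tl# x₀)
      ∣ call rounds# (tl# (hd# x₀) ⊙ hd# (tl# x₀) ⊙
          call relaxAll# (hd# (hd# (tl# x₀)) ⊙ tl# (hd# (tl# x₀)) ⊙ nil ⊙ tl# (tl# x₀))) ⟩
    -- bump: class ∙ counters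
  ∷ ifnil hd# x₀
      ⟨ nil
      ∣ (ifnil hd# (hd# x₀) ⟨ hd# (tl# x₀) ∣ nil ⊙ hd# (tl# x₀) ⟩) ⊙
        call bump# (tl# (hd# x₀) ⊙ tl# (tl# x₀)) ⟩
    -- counts: classes ∙ ends
  ∷ ifnil hd# x₀
      ⟨ call blank# (tl# x₀)
      ∣ call bump# (hd# (hd# x₀) ⊙ call counts# (tl# (hd# x₀) ⊙ tl# x₀)) ⟩
    -- collect: counters ∙ number of the first arc
  ∷ ifnil hd# x₀
      ⟨ nil
      ∣ let' (call collect# (tl# (hd# x₀) ⊙ (nil ⊙ tl# x₀)))
        -- Numerals are unary, so a counter is at least 2 exactly if its tail is not `nil`.
        (ifnil tl# (hd# (hd# x₁)) ⟨ x₀ ∣ tl# x₁ ⊙ x₀ ⟩) ⟩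
    -- single: counters
  ∷ ifnil x₀
      ⟨ nil
      ∣ (ifnil tl# (hd# x₀) ⟨ true# ∣ nil ⟩) ⊙ call single# (tl# x₀) ⟩
    -- pos: costs
  ∷ ifnil x₀
      ⟨ nil
      ∣ (ifnil op₂ leq zero# (hd# x₀) ⟨ zero# ∣ hd# x₀ ⟩) ⊙ call pos# (tl# x₀) ⟩
    -- negs: costs
  ∷ ifnil x₀
      ⟨ nil
      ∣ (ifnil op₂ leq zero# (hd# x₀) ⟨ true# ∣ nil ⟩) ⊙ call negs# (tl# x₀) ⟩
    -- meet: set ∙ set
  ∷ ifnil hd# x₀
      ⟨ nil
      ∣ (ifnil hd# (hd# x₀) ⟨ nil ∣ hd# (tl# x₀) ⟩) ⊙
        call meet# (tl# (hd# x₀) ⊙ tl# (tl# x₀)) ⟩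
    -- compress: mask ∙ list
  ∷ ifnil hd# x₀
      ⟨ nil
      ∣ let' (call compress# (tl# (hd# x₀) ⊙ tl# (tl# x₀)))
        (ifnil hd# (hd# x₁) ⟨ x₀ ∣ hd# (tl# x₁) ⊙ x₀ ⟩) ⟩
    -- expand: mask ∙ set within the mask ∙ set
  ∷ ifnil hd# x₀
      ⟨ nil
      ∣ ifnil hd# (hd# x₀)
          ⟨ hd# (tl# (tl# x₀)) ⊙
            call expand# (tl# (hd# x₀) ⊙ hd# (tl# x₀) ⊙ tl# (tl# (tl# x₀)))
          ∣ (ifnil hd# (hd# (tl# x₀)) ⟨ hd# (tl# (tl# x₀)) ∣ true# ⟩) ⊙
            call expand# (tl# (hd# x₀) ⊙ tl# (hd# (tl# x₀)) ⊙ tl# (tl# (tl# x₀))) ⟩ ⟩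
    -- setCost: costs ∙ set
  ∷ ifnil hd# x₀
      ⟨ zero#
      ∣ op₂ add (ifnil hd# (tl# x₀) ⟨ zero# ∣ hd# (hd# x₀) ⟩)
                (call setCost# (tl# (hd# x₀) ⊙ tl# (tl# x₀))) ⟩
    -- gather: classes ∙ set ∙ (mask ∙ costs) ∙ number of vertices ∙ ends ∙ terminals
  ∷ ifnil hd# x₀
      ⟨ nil ⊙ hd# (tl# x₀)
      ∣ let' (call gather# (tl# (hd# x₀) ⊙ tl# x₀))
        (let' (call meet# (hd# (hd# (tl# (tl# x₁))) ⊙ hd# (hd# x₁)))
        -- The query is made before the result for the other classes is inspected: one query per
        -- class, whatever the outcome.
        (let' (ask (hd# (tl# (tl# (tl# x₂))) ⊙
                    call compress# (x₀ ⊙ hd# (tl# (tl# (tl# (tl# x₂))))) ⊙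
                    call compress# (x₀ ⊙ tl# (hd# (tl# (tl# x₂)))) ⊙
                    tl# (tl# (tl# (tl# (tl# x₂))))))
        gatherResult)) ⟩
    -- solve: arcs ∙ (mask ∙ costs) ∙ classes ∙ original costs ∙ set ∙
    --        number of vertices ∙ ends ∙ terminals
  ∷ ifnil hd# x₀
      ⟨ let' (call gather# (hd# (tl# (tl# x₀)) ⊙ hd# (tl# (tl# (tl# (tl# x₀)))) ⊙
                            hd# (tl# x₀) ⊙ tl# (tl# (tl# (tl# (tl# x₀))))))
        (ifnil x₀ ⟨ nil ∣
          call setCost# (hd# (tl# (tl# (tl# x₁))) ⊙ tl# x₀) ⊙ tl# x₀ ⟩)
      ∣ let' (call solve# (tl# (hd# x₀) ⊙ tl# x₀))
        (let' (call solve# (tl# (hd# x₁) ⊙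
                 -- The second branch buys the arc. It enters the mask and is charged nothing from
                 -- now on; its true cost is counted by `setCost#` at the leaf.
                 (call update# (hd# (hd# x₁) ⊙ hd# (hd# (tl# x₁)) ⊙ true#) ⊙
                  call update# (hd# (hd# x₁) ⊙ tl# (hd# (tl# x₁)) ⊙ zero#)) ⊙
                 tl# (tl# x₁)))
        (ifnil x₀ ⟨ x₁ ∣
         ifnil x₁ ⟨ x₀ ∣
         ifnil op₂ leq (hd# x₀) (hd# x₁) ⟨ x₁ ∣ x₀ ⟩ ⟩ ⟩)) ⟩
    -- double: number
  ∷ ifnil x₀ ⟨ nil ∣ nil ⊙ nil ⊙ call double# (tl# x₀) ⟩
    -- pow: number
  ∷ ifnil x₀ ⟨ true# ∣ call double# (call pow# (tl# x₀)) ⟩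
  ∷ []

shortestPathProgram : Orientation → Program
shortestPathProgram o = record
  { body = library o
  ; main =
      let' (call update# (tl# (tl# (tl# (tl# x₀))) ⊙ call blank# (hd# x₀) ⊙
                          zero# ⊙ call blank# (hd# (tl# x₀))))
      (let' (call rounds# (hd# x₁ ⊙ (hd# (tl# x₁) ⊙ hd# (tl# (tl# x₁))) ⊙ x₀))
      (let' (call lookup# (hd# (tl# (tl# (tl# x₂))) ⊙ x₀))
      (ifnil x₀ ⟨ nil ∣ nil ⊙ tl# x₀ ⟩)))
  }

superset : Orientation → Program
superset o = record
  { body = library o
  ; main =
      let' (call counts# (tl# x₀ ⊙ hd# (tl# (hd# x₀))))
      (let' (call solve# (call collect# (x₀ ⊙ nil) ⊙
                          (call single# x₀ ⊙ call pos# (hd# (tl# (tl# (hd# x₁))))) ⊙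
                          tl# x₁ ⊙ hd# (tl# (tl# (hd# x₁))) ⊙
                          call negs# (hd# (tl# (tl# (hd# x₁)))) ⊙
                          hd# (hd# x₁) ⊙ hd# (tl# (hd# x₁)) ⊙ tl# (tl# (tl# (hd# x₁)))))
      (ifnil x₀ ⟨ nil ∣ nil ⊙ tl# x₀ ⟩))
  }

powers : Program
powers = record { body = library directed ; main = call pow# x₀ }

-- A calculus of evaluations with time bounds

IsSimple : ∀ {F Γ} → Exp F Γ → Bool
IsSimple (var x)               = true
IsSimple nil                   = true
IsSimple zero#                 = true
IsSimple (op₁ ω e)             = IsSimple e
IsSimple (op₂ ω e₁ e₂)         = IsSimple e₁ ∧ IsSimple e₂
IsSimple (ifnil e ⟨ e₁ ∣ e₂ ⟩) = IsSimple e ∧ IsSimple e₁ ∧ IsSimple e₂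
IsSimple (let' e₁ e₂)          = false
IsSimple (call f e)            = false
IsSimple (ask e)               = false

nodes : ∀ {F Γ} → Exp F Γ → ℕ
nodes (op₁ ω e)             = 1 ℕ.+ nodes e
nodes (op₂ ω e₁ e₂)         = 1 ℕ.+ nodes e₁ ℕ.+ nodes e₂
nodes (ifnil e ⟨ e₁ ∣ e₂ ⟩) = 1 ℕ.+ nodes e ℕ.+ (nodes e₁ ℕ.+ nodes e₂)
nodes _                     = 1

T-∧ : ∀ b {c} → T (b ∧ c) → T b × T c
T-∧ true p = _ , p

opaque

  -- The numerals in the time bounds are round upper bounds on the number of
  -- expressions evaluated in one function body.
  linear : ℕ → ℕ
  linear j = suc j * 50

  linear≤ : ∀ {j M} → j ℕ.≤ M → linear j ℕ.≤ 50 * suc M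
  linear≤ {j} {M} j≤M = ℕ.≤-trans (ℕ.*-monoˡ-≤ 50 (s≤s j≤M)) (ℕ.≤-reflexive (ℕ.*-comm (suc M) 50))

module Semantics {a ℓ₁ ℓ₂ : Level} (K : OrderedAbelianGroup a ℓ₁ ℓ₂) where

  open OrderedAbelianGroup K using (Carrier; 0#; _+_; _≤?_)
  open Costs K

  if-nil-then : Value → Value → Value → Value
  if-nil-then nil v w = v
  if-nil-then _   v w = w

  val : ∀ {F Γ} → Exp F Γ → Vec Value Γ → Value
  val (var x)               ρ = lookup ρ x
  val zero#                 ρ = num 0#
  val (op₁ ω e)             ρ = ⟦ ω ⟧₁ (val e ρ)
  val (op₂ ω e₁ e₂)         ρ = ⟦ ω ⟧₂ (val e₁ ρ) (val e₂ ρ)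
  val (ifnil e ⟨ e₁ ∣ e₂ ⟩) ρ = if-nil-then (val e ρ) (val e₁ ρ) (val e₂ ρ)
  val _                     ρ = nil

  module Derivations (Sub : Subroutine) (o : Orientation) where

    -- Code without calls, bindings and queries needs no derivation by hand: `val` computes its
    -- value, and `nodes` bounds its time, as each node is evaluated at most once.
    simple-eval : ∀ {F Γ} {fs : Vec (Exp F 1) F} (e : Exp F Γ) (ρ : Vec Value Γ) →
                  T (IsSimple e) →
                  ∃[ t ] Eval Sub fs ρ e (val e ρ) t [] × t ℕ.≤ nodes e
    simple-eval (var x) ρ _ = 1 , var x , ℕ.≤-refl
    simple-eval nil     ρ _ = 1 , nil , ℕ.≤-refl
    simple-eval zero#   ρ _ = 1 , zero# , ℕ.≤-refl
    simple-eval (op₁ ω e) ρ s with simple-eval e ρ s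
    ... | t , D , t≤ = _ , op₁ ω D , s≤s t≤
    simple-eval (op₂ ω e₁ e₂) ρ s with T-∧ (IsSimple e₁) s
    ... | s₁ , s₂ with simple-eval e₁ ρ s₁ | simple-eval e₂ ρ s₂
    ... | t₁ , D₁ , t₁≤ | t₂ , D₂ , t₂≤ =
      _ , op₂ ω D₁ D₂ , s≤s (ℕ.+-mono-≤ t₁≤ t₂≤)
    simple-eval (ifnil e ⟨ e₁ ∣ e₂ ⟩) ρ s with T-∧ (IsSimple e) s
    ... | s₀ , s₁₂ with T-∧ (IsSimple e₁) s₁₂
    ... | s₁ , s₂
      with val e ρ | simple-eval e ρ s₀ | simple-eval e₁ ρ s₁ | simple-eval e₂ ρ s₂
    ... | nil   | t , D , t≤ | t₁ , D₁ , t₁≤ | t₂ , D₂ , t₂≤ =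
      _ , if-nil D D₁ , s≤s (ℕ.+-mono-≤ t≤ (ℕ.≤-trans t₁≤ (ℕ.m≤m+n _ _)))
    ... | num x | t , D , t≤ | t₁ , D₁ , t₁≤ | t₂ , D₂ , t₂≤ =
      _ , if-non D (λ ()) D₂ , s≤s (ℕ.+-mono-≤ t≤ (ℕ.≤-trans t₂≤ (ℕ.m≤n+m _ _)))
    ... | _ ∙ _ | t , D , t≤ | t₁ , D₁ , t₁≤ | t₂ , D₂ , t₂≤ =
      _ , if-non D (λ ()) D₂ , s≤s (ℕ.+-mono-≤ t≤ (ℕ.≤-trans t₂≤ (ℕ.m≤n+m _ _)))

    -- The time is at most C * suc u + sum r.  The list r collects the times of
    -- recursive calls; keeping it apart makes C a numeral, so that the bounds
    -- below are checked by computation.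
    record Ev (u : ℕ) {Γ : ℕ} (ρ : Vec Value Γ) (e : Exp 21 Γ) (v : Value)
              (C : ℕ) (r : List ℕ) (qs : List Value) : Set a where
      constructor ev
      field
        {time} : ℕ
        eval   : Eval Sub (library o) ρ e v time qs
        bound  : time ℕ.≤ C * suc u ℕ.+ ℕ.sum r

    pad : ∀ {u Γ} {ρ : Vec Value Γ} {e v C r qs} L {_ : T (C ℕ.≤ᵇ L)} → Ev u ρ e v C r qs → Ev u ρ e v L r qs
    pad {u} {C = C} L {p} (ev D t≤) = ev D (ℕ.≤-trans t≤ (ℕ.+-monoˡ-≤ _ (ℕ.*-monoˡ-≤ (suc u) (ℕ.≤ᵇ⇒≤ C L p))))

    record Call (f : Fin 21) (v w : Value) (B : ℕ) (qs : List Value) : Set a where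
      constructor returns
      field
        {time} : ℕ
        eval   : Eval Sub (library o) (v ∷ []) (lookup (library o) f) w time qs
        bound  : time ℕ.≤ B

    result : ∀ {f v w w′ B qs} → w ≡ w′ → Call f v w B qs → Call f v w′ B qs
    result refl D = D

    argument : ∀ {f v v′ w B qs} → v ≡ v′ → Call f v w B qs → Call f v′ w B qs
    argument refl D = D

    within : ∀ {f v w B B′ qs} → B ℕ.≤ B′ → Call f v w B qs → Call f v w B′ qs
    within B≤ (returns D t≤) = returns D (ℕ.≤-trans t≤ B≤)

    from-body : ∀ {u f v w C r B qs} →
                Ev u (v ∷ []) (lookup (library o) f) w C r qs →
                C * suc u ℕ.+ ℕ.sum r ℕ.≤ B → Call f v w B qs
    from-body (ev D t≤) B≥ = returns D (ℕ.≤-trans t≤ B≥)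

    module _ {u Γ : ℕ} {ρ : Vec Value Γ} where

      private
        -- The single step of the node itself is at most one unit `suc u`, so each construct raises
        -- the coefficient by one.
        combine : ∀ {t₁ t₂} C₁ C₂ r₁ r₂ →
                  t₁ ℕ.≤ C₁ * suc u ℕ.+ ℕ.sum r₁ → t₂ ℕ.≤ C₂ * suc u ℕ.+ ℕ.sum r₂ →
                  1 ℕ.+ t₁ ℕ.+ t₂ ℕ.≤ (1 ℕ.+ C₁ ℕ.+ C₂) * suc u ℕ.+ ℕ.sum (r₁ ++ r₂)
        combine {t₁} {t₂} C₁ C₂ r₁ r₂ p₁ p₂ = begin
          1 ℕ.+ t₁ ℕ.+ t₂
            ≤⟨ ℕ.+-mono-≤ (ℕ.+-mono-≤ (s≤s (z≤n {u})) p₁) p₂ ⟩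
          suc u ℕ.+ (C₁ * suc u ℕ.+ ℕ.sum r₁) ℕ.+ (C₂ * suc u ℕ.+ ℕ.sum r₂)
            ≡⟨ cong (ℕ._+ (C₂ * suc u ℕ.+ ℕ.sum r₂)) (sym (ℕ.+-assoc (suc u) (C₁ * suc u) (ℕ.sum r₁))) ⟩
          (suc C₁ * suc u ℕ.+ ℕ.sum r₁) ℕ.+ (C₂ * suc u ℕ.+ ℕ.sum r₂)
            ≡⟨ ℕ.+-assoc (suc C₁ * suc u) _ _ ⟩
          suc C₁ * suc u ℕ.+ (ℕ.sum r₁ ℕ.+ (C₂ * suc u ℕ.+ ℕ.sum r₂))
            ≡⟨ cong (suc C₁ * suc u ℕ.+_)
                 (trans (sym (ℕ.+-assoc (ℕ.sum r₁) _ _))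
                 (trans (cong (ℕ._+ ℕ.sum r₂) (ℕ.+-comm (ℕ.sum r₁) _)) (ℕ.+-assoc (C₂ * suc u) _ _))) ⟩
          suc C₁ * suc u ℕ.+ (C₂ * suc u ℕ.+ (ℕ.sum r₁ ℕ.+ ℕ.sum r₂))
            ≡⟨ sym (ℕ.+-assoc (suc C₁ * suc u) _ _) ⟩
          suc C₁ * suc u ℕ.+ C₂ * suc u ℕ.+ (ℕ.sum r₁ ℕ.+ ℕ.sum r₂)
            ≡⟨ cong₂ ℕ._+_ (sym (ℕ.*-distribʳ-+ (suc u) (suc C₁) C₂)) (sym (ℕ.sum-++ r₁ r₂)) ⟩
          (1 ℕ.+ C₁ ℕ.+ C₂) * suc u ℕ.+ ℕ.sum (r₁ ++ r₂) ∎
          where open ℕ.≤-Reasoning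

      simple : ∀ {e : Exp 21 Γ} {_ : T (IsSimple e)} → Ev u ρ e (val e ρ) (nodes e) [] []
      simple {e} {s} with simple-eval e ρ s
      ... | t , D , t≤ = ev D (ℕ.≤-trans t≤ (ℕ.≤-trans (ℕ.m≤m*n (nodes e) (suc u)) (ℕ.m≤m+n _ 0)))

      infixr 5 _⊕_
      _⊕_ : ∀ {ω e₁ e₂ v₁ v₂ C₁ C₂ r₁ r₂ qs₁ qs₂} →
            Ev u ρ e₁ v₁ C₁ r₁ qs₁ → Ev u ρ e₂ v₂ C₂ r₂ qs₂ →
            Ev u ρ (op₂ ω e₁ e₂) (⟦ ω ⟧₂ v₁ v₂) (1 ℕ.+ C₁ ℕ.+ C₂) (r₁ ++ r₂) (qs₁ ++ qs₂)
      _⊕_ {ω} {C₁ = C₁} {C₂} {r₁} {r₂} (ev D₁ p₁) (ev D₂ p₂) =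
        ev (op₂ ω D₁ D₂) (combine C₁ C₂ r₁ r₂ p₁ p₂)

      then# : ∀ {e e₁ e₂ v₁ C C₁ r r₁ qs qs₁} →
              Ev u ρ e nil C r qs → Ev u ρ e₁ v₁ C₁ r₁ qs₁ →
              Ev u ρ (ifnil e ⟨ e₁ ∣ e₂ ⟩) v₁ (1 ℕ.+ C ℕ.+ C₁) (r ++ r₁) (qs ++ qs₁)
      then# {C = C} {C₁} {r} {r₁} (ev D p) (ev D₁ p₁) =
        ev (if-nil D D₁) (combine C C₁ r r₁ p p₁)

      else# : ∀ {e e₁ e₂ v w v₂ C C₂ r r₂ qs qs₂} →
              Ev u ρ e (v ∙ w) C r qs → Ev u ρ e₂ v₂ C₂ r₂ qs₂ →
              Ev u ρ (ifnil e ⟨ e₁ ∣ e₂ ⟩) v₂ (1 ℕ.+ C ℕ.+ C₂) (r ++ r₂) (qs ++ qs₂)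
      else# {C = C} {C₂} {r} {r₂} (ev D p) (ev D₂ p₂) =
        ev (if-non D (λ ()) D₂) (combine C C₂ r r₂ p p₂)

      let# : ∀ {e₁ e₂ v₁ v₂ C₁ C₂ r₁ r₂ qs₁ qs₂} →
             Ev u ρ e₁ v₁ C₁ r₁ qs₁ → Ev u (v₁ ∷ ρ) e₂ v₂ C₂ r₂ qs₂ →
             Ev u ρ (let' e₁ e₂) v₂ (1 ℕ.+ C₁ ℕ.+ C₂) (r₁ ++ r₂) (qs₁ ++ qs₂)
      let# {C₁ = C₁} {C₂} {r₁} {r₂} (ev D₁ p₁) (ev D₂ p₂) =
        ev (let' D₁ D₂) (combine C₁ C₂ r₁ r₂ p₁ p₂)

      -- The bound of the callee is split into a multiple of the unit and a rest that stays
      -- symbolic: `recurse` puts everything into the rest, `subcall` nothing.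
      call# : ∀ {f e v w C r B B′ qs qs′} K →
              Ev u ρ e v C r qs → Call f v w B qs′ → B ℕ.≤ K * suc u ℕ.+ ℕ.sum B′ →
              Ev u ρ (call f e) w (1 ℕ.+ C ℕ.+ K) (r ++ B′) (qs ++ qs′)
      call# {f} {C = C} {r} {B′ = B′} K (ev D p) (returns D′ p′) B≤ =
        ev (call f D D′) (combine C K r B′ p (ℕ.≤-trans p′ B≤))

      recurse : ∀ {f e v w C r B qs qs′} →
                Ev u ρ e v C r qs → Call f v w B qs′ →
                Ev u ρ (call f e) w (1 ℕ.+ C ℕ.+ 0) (r ++ B ∷ []) (qs ++ qs′)
      recurse D D′ = call# 0 D D′ (ℕ.m≤m+n _ 0)

      subcall : ∀ {f e v w C r B qs qs′} K →
                Ev u ρ e v C r qs → Call f v w B qs′ → B ℕ.≤ K * suc u →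
                Ev u ρ (call f e) w (1 ℕ.+ C ℕ.+ K) (r ++ []) (qs ++ qs′)
      subcall K D D′ B≤ = call# {B′ = []} K D D′ (ℕ.≤-trans B≤ (ℕ.m≤m+n _ 0))

      -- The unit is later chosen above the running time of the subroutine, so that a query costs
      -- one unit.
      ask# : ∀ {e v w t C r qs} →
             Ev u ρ e v C r qs → Sub v w t → t ℕ.≤ suc u →
             Ev u ρ (ask e) w (1 ℕ.+ C ℕ.+ 1) (r ++ []) (qs ++ v ∷ [])
      ask# {t = t} {C} {r} (ev D p) q t≤ =
        ev (ask D q) (combine C 1 r [] p (ℕ.≤-trans t≤ (ℕ.≤-reflexive (sym eq))))
        where
        eq : 1 * suc u ℕ.+ 0 ≡ suc u
        eq = trans (ℕ.+-identityʳ _) (ℕ.*-identityˡ (suc u))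

    bounded-eval : ∀ {Γ} {ρ : Vec Value Γ} {e v C qs} u L {_ : T (C ℕ.≤ᵇ L)} → Ev u ρ e v C [] qs →
                   ∃[ time ] Eval Sub (library o) ρ e v time qs × time ℕ.≤ L * suc u
    bounded-eval {C = C} u L {p} (ev D t≤) = _ , D ,
      ℕ.≤-trans t≤ (ℕ.≤-trans (ℕ.≤-reflexive (ℕ.+-identityʳ _)) (ℕ.*-monoˡ-≤ (suc u) (ℕ.≤ᵇ⇒≤ C L p)))

    bounded : ∀ {f v w C qs} u L {_ : T (C ℕ.≤ᵇ L)} →
              Ev u (v ∷ []) (lookup (library o) f) w C [] qs → Call f v w (L * suc u) qs
    bounded u L {p} D with bounded-eval u L {p} D
    ... | _ , D′ , t≤ = returns D′ t≤

    base-case : ∀ {f v w C qs} u j L {_ : T (C ℕ.≤ᵇ L)} →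
                Ev u (v ∷ []) (lookup (library o) f) w C [] qs →
                Call f v w (suc j * (L * suc u)) qs
    base-case u j L {p} D = within (ℕ.m≤m+n _ _) (bounded u L {p} D)

    step-case : ∀ {f v w C R qs} u j L {_ : T (C ℕ.≤ᵇ L)} → R ≡ j * (L * suc u) →
                Ev u (v ∷ []) (lookup (library o) f) w C (R ∷ []) qs →
                Call f v w (suc j * (L * suc u)) qs
    step-case {C = C} u j L {p} refl D = from-body D (begin
      C * suc u ℕ.+ (j * (L * suc u) ℕ.+ 0)  ≡⟨ cong (C * suc u ℕ.+_) (ℕ.+-identityʳ _) ⟩
      C * suc u ℕ.+ j * (L * suc u)          ≤⟨ ℕ.+-monoˡ-≤ _ (ℕ.*-monoˡ-≤ (suc u) (ℕ.≤ᵇ⇒≤ C L p)) ⟩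
      suc j * (L * suc u)                    ∎)
      where open ℕ.≤-Reasoning

    opaque

      unfolding linear

      -- With `u = 0` the unit is one step: a traversal of a list spends at most 50 steps on each
      -- entry and 50 at the end.
      stop : ∀ {f v w C qs} j {_ : T (C ℕ.≤ᵇ 50)} →
             Ev 0 (v ∷ []) (lookup (library o) f) w C [] qs → Call f v w (linear j) qs
      stop j {p} = base-case 0 j 50 {p}

      again : ∀ {f v w C qs} j {_ : T (C ℕ.≤ᵇ 50)} →
              Ev 0 (v ∷ []) (lookup (library o) f) w C (linear j ∷ []) qs →
              Call f v w (linear (suc j)) qs
      again j {p} = step-case 0 (suc j) 50 {p} refl

    -- Entries come from a function because the type of a label depends on its vertex, which a `Vec`
    -- cannot express. Updates are accordingly specified pointwise.
    list : ∀ {j} → (Fin j → Value) → Value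
    list {zero}  g = nil
    list {suc j} g = g zero ∙ list (g ∘ suc)

    vec-list : ∀ {b} {A : Set b} (f : A → Value) {j} (xs : Vec A j) →
               vec f xs ≡ list (f ∘ lookup xs)
    vec-list f []       = refl
    vec-list f (x ∷ xs) = cong (f x ∙_) (vec-list f xs)

    list-cong : ∀ {j} {g h : Fin j → Value} → (∀ i → g i ≡ h i) → list g ≡ list h
    list-cong {zero}  eq = refl
    list-cong {suc j} eq = cong₂ _∙_ (eq zero) (list-cong (eq ∘ suc))

    lookup-returns : ∀ {j} (i : Fin j) (g : Fin j → Value) →
                     Call lookup# (fin i ∙ list g) (g i) (linear j) []
    lookup-returns {suc j} zero    g = stop (suc j) (then# simple simple)
    lookup-returns {suc j} (suc i) g =
      again j (else# simple (recurse simple (lookup-returns i (g ∘ suc))))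

    update-returns : ∀ {j} (i : Fin j) (g h : Fin j → Value) {w} →
                     w ≡ h i → (∀ x → x ≢ i → g x ≡ h x) →
                     Call update# (fin i ∙ list g ∙ w) (list h) (linear j) []
    update-returns {suc j} zero g h eq eqs =
      result (cong₂ _∙_ eq (list-cong λ x → eqs (suc x) λ ()))
        (stop (suc j) (then# simple simple))
    update-returns {suc j} (suc i) g h eq eqs =
      result (cong (_∙ list (h ∘ suc)) (eqs zero λ ()))
        (again j
          (else# simple (simple ⊕ recurse simple
            (update-returns i (g ∘ suc) (h ∘ suc) eq λ x x≢i → eqs (suc x) λ { refl → x≢i refl }))))

    blank-returns : ∀ {j} (g : Fin j → Value) → Call blank# (list g) (list {j} λ _ → nil) (linear j) []
    blank-returns {zero}  g = stop 0 (then# simple simple)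
    blank-returns {suc j} g =
      again j (else# simple (simple ⊕ recurse simple (blank-returns (g ∘ suc))))

-- Preliminaries on lists, sets and ordered groups

Unique⇒lookup-injective : ∀ {a} {A : Set a} {xs : List A} → Unique xs →
                          ∀ {i j} → List.lookup xs i ≡ List.lookup xs j → i ≡ j
Unique⇒lookup-injective (_ ∷ _)   {zero}  {zero}  eq = refl
Unique⇒lookup-injective (px ∷ _)  {zero}  {suc j} eq = contradiction eq (All.lookup px (∈-lookup j))
Unique⇒lookup-injective (px ∷ _)  {suc i} {zero}  eq = contradiction (sym eq) (All.lookup px (∈-lookup i))
Unique⇒lookup-injective (_ ∷ pxs) {suc i} {suc j} eq = cong suc (Unique⇒lookup-injective pxs eq)

length-unique : ∀ {n} {xs : List (Fin n)} → Unique xs → length xs ℕ.≤ n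
length-unique {xs = xs} uniq = injective⇒≤ {f = List.lookup xs} (Unique⇒lookup-injective uniq)

-- The change of unit for a loop: `suc M * suc u` is `suc (u + M * suc u)` by computation, so the
-- loop costs `L` of the larger units. This is the origin of `M²`, `M³` and `u′`.
repeat≤ : ∀ {j M} L u → j ℕ.≤ M → suc j * (L * suc u) ℕ.≤ L * (suc M * suc u)
repeat≤ {j} {M} L u j≤M = begin
  suc j * (L * suc u)  ≤⟨ ℕ.*-monoˡ-≤ (L * suc u) (s≤s j≤M) ⟩
  suc M * (L * suc u)  ≡⟨ ℕ.*-assoc (suc M) L (suc u) ⟨
  suc M * L * suc u    ≡⟨ cong (_* suc u) (ℕ.*-comm (suc M) L) ⟩
  L * suc M * suc u    ≡⟨ ℕ.*-assoc L (suc M) (suc u) ⟩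
  L * (suc M * suc u)  ∎
  where open ℕ.≤-Reasoning

lookup-insert : ∀ {m} (a : Fin m) (p : Subset m) → lookup (⁅ a ⁆ ∪ p) a ≡ true
lookup-insert a p = trans (lookup-zipWith _∨_ a ⁅ a ⁆ p) (cong (_∨ lookup p a) ([]=⇒lookup (x∈⁅x⁆ a)))

lookup-insert-≢ : ∀ {m} {a x : Fin m} (p : Subset m) → x ≢ a → lookup (⁅ a ⁆ ∪ p) x ≡ lookup p x
lookup-insert-≢ {a = a} {x} p x≢a = trans (lookup-zipWith _∨_ x ⁅ a ⁆ p) (cong (_∨ lookup p x) outside)
  where
  outside : lookup ⁅ a ⁆ x ≡ false
  outside with lookup ⁅ a ⁆ x in eq
  ... | false = refl
  ... | true  = contradiction (lookup⇒[]= x ⁅ a ⁆ eq) (x≢y⇒x∉⁅y⁆ x≢a)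

module OrderedGroupProperties {a ℓ₁ ℓ₂ : Level} (K : OrderedAbelianGroup a ℓ₁ ℓ₂) where

  open OrderedAbelianGroup K public

  abelianGroup : AbelianGroup a ℓ₁
  abelianGroup = record { isAbelianGroup = isAbelianGroup }

  open AbelianGroup abelianGroup public
    using (commutativeMonoid; identityˡ; identityʳ)
    renaming (refl to ≈-refl; reflexive to ≈-reflexive; sym to ≈-sym; trans to ≈-trans;
              comm to +-comm; ∙-congˡ to +-congˡ)

  open IsDecTotalOrder isDecTotalOrder public
    using (isPartialOrder; total) renaming (refl to ≤-refl; trans to ≤-trans; reflexive to ≤-reflexive)

  poset : Poset a ℓ₁ ℓ₂
  poset = record { isPartialOrder = isPartialOrder }

  ≰⇒≥ : ∀ {x y} → ¬ x ≤ y → y ≤ x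
  ≰⇒≥ {x} {y} x≰y with total x y
  ... | inj₁ x≤y = contradiction x≤y x≰y
  ... | inj₂ y≤x = y≤x

  +-monoʳ-≤ : ∀ z {x y} → x ≤ y → z + x ≤ z + y
  +-monoʳ-≤ z {x} {y} x≤y = begin
    z + x  ≈⟨ +-comm z x ⟩
    x + z  ≤⟨ +-monoˡ-≤ z x≤y ⟩
    y + z  ≈⟨ +-comm y z ⟩
    z + y  ∎
    where open import Relation.Binary.Reasoning.PartialOrder poset

  +-mono-≤ : ∀ {x y u v} → x ≤ y → u ≤ v → x + u ≤ y + v
  +-mono-≤ x≤y u≤v = ≤-trans (+-monoˡ-≤ _ x≤y) (+-monoʳ-≤ _ u≤v)

  x≤z+x : ∀ {z x} → 0# ≤ z → x ≤ z + x
  x≤z+x {z} {x} 0≤z = begin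
    x       ≈⟨ identityˡ x ⟨
    0# + x  ≤⟨ +-monoˡ-≤ x 0≤z ⟩
    z + x   ∎
    where open import Relation.Binary.Reasoning.PartialOrder poset

  posPart : Carrier → Carrier
  posPart x = if does (0# ≤? x) then x else 0#

  posPart≥0 : ∀ x → 0# ≤ posPart x
  posPart≥0 x with 0# ≤? x
  ... | yes 0≤x = 0≤x
  ... | no _    = ≤-refl

  negative : Carrier → Bool
  negative x = not (does (0# ≤? x))

-- Correctness of the Bellman-Ford labels

module Labelling {a ℓ₁ ℓ₂ : Level} (K : OrderedAbelianGroup a ℓ₁ ℓ₂)
                 (o : Orientation) (N : Costs.Network K) where

  open OrderedGroupProperties K
  open Costs K
  open Semantics K
  open Derivations none o
  open Network N

  Labels : Set
  Labels = ∀ u → Maybe (Walk o E u t)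

  label : ∀ {u} → Maybe (Walk o E u t) → Value
  label nothing  = nil
  label (just W) = num (walkCost cost W) ∙ subset (arcSet W)

  labels : Labels → Value
  labels D = list (label ∘ D)

  set : Labels → ∀ u → Walk o E u t → Labels
  set D u W x with x ≟ u
  ... | yes refl = just W
  ... | no _     = D x

  -- Ties keep the old label; otherwise a cycle of cost zero could be closed.
  improves : ∀ {u} → Walk o E u t → Maybe (Walk o E u t) → Bool
  improves W nothing   = true
  improves W (just W₀) = not (does (walkCost cost W₀ ≤? walkCost cost W))

  improve : ∀ {u} → Maybe (Walk o E u t) → Labels → Labels
  improve     nothing  D = D
  improve {u} (just W) D = if improves W (D u) then set D u W else D

  relax : ∀ {u v} a → Traverses o (lookup E a) u v → Labels → Labels
  relax {v = v} a tr D = improve (Maybe.map (step a tr) (D v)) D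

  -- A traversal in the opposite direction, if the orientation allows one.
  reversal : ∀ o′ (e : Fin n × Fin n) → Maybe (Traverses o′ e (proj₂ e) (proj₁ e))
  reversal directed   e = nothing
  reversal undirected e = just (inj₂ refl)

  forward : ∀ o′ (e : Fin n × Fin n) → Traverses o′ e (proj₁ e) (proj₂ e)
  forward directed   e = refl
  forward undirected e = inj₁ refl

  relaxForward : Fin m → Labels → Labels
  relaxForward a = relax a (forward o (lookup E a))

  relaxArc : Fin m → Labels → Labels
  relaxArc a D =
    Maybe.maybe′ (λ tr → relax a tr (relaxForward a D)) (relaxForward a D) (reversal o (lookup E a))

  relaxArcs : ∀ {j} → (Fin j → Fin m) → Labels → Labels
  relaxArcs {zero}  g D = D
  relaxArcs {suc j} g D = relaxArcs (g ∘ suc) (relaxArc (g zero) D)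

  relaxTimes : ℕ → Labels → Labels
  relaxTimes zero    D = D
  relaxTimes (suc i) D = relaxTimes i (relaxArcs (λ a → a) D)

  initial : Labels
  initial = set (λ _ → nothing) t []

  Reached : Labels → Fin n → Carrier → Set ℓ₂
  Reached D u x = Σ[ W ∈ Walk o E u t ] D u ≡ just W × walkCost cost W ≤ x

  infix 4 _≼_
  _≼_ : Labels → Labels → Set (a ⊔ ℓ₂)
  D ≼ D′ = ∀ {u x} → Reached D u x → Reached D′ u x

  set-≡ : ∀ D u W → set D u W u ≡ just W
  set-≡ D u W with u ≟ u
  ... | yes refl = refl
  ... | no u≢u   = contradiction refl u≢u

  set-≢ : ∀ D u W {x} → x ≢ u → set D u W x ≡ D x
  set-≢ D u W {x} x≢u with x ≟ u
  ... | yes refl = contradiction refl x≢u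
  ... | no _     = refl

  not-improving : ∀ {u} (W : Walk o E u t) (D : Labels) →
                  improves W (D u) ≡ false → Reached D u (walkCost cost W)
  not-improving {u} W D eq with D u
  ... | just W₀ with walkCost cost W₀ ≤? walkCost cost W
  ...   | yes W₀≤W = W₀ , refl , W₀≤W

  improving : ∀ {u} (W : Walk o E u t) (D : Labels) →
              improves W (D u) ≡ true → ¬ Reached D u (walkCost cost W)
  improving {u} W D eq (W₀ , eq₀ , W₀≤W) rewrite eq₀ with walkCost cost W₀ ≤? walkCost cost W
  ... | no W₀≰W = W₀≰W W₀≤W

  ≼-set : ∀ {u} (W : Walk o E u t) (D : Labels) → improves W (D u) ≡ true → D ≼ set D u W
  ≼-set {u} W D eq {x} (W₀ , eq₀ , W₀≤x) with x ≟ u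
  ... | no _     = W₀ , eq₀ , W₀≤x
  ... | yes refl = W , refl ,
    ≤-trans (≰⇒≥ λ W₀≤W → improving W D eq (W₀ , eq₀ , W₀≤W)) W₀≤x

  ≼-improve : ∀ {u} (W : Maybe (Walk o E u t)) (D : Labels) → D ≼ improve W D
  ≼-improve     nothing  D r = r
  ≼-improve {u} (just W) D r with improves W (D u) in eq
  ... | true  = ≼-set W D eq r
  ... | false = r

  improve-reached : ∀ {u} (W : Walk o E u t) (D : Labels) →
                    Reached (improve (just W) D) u (walkCost cost W)
  improve-reached {u} W D with improves W (D u) in eq
  ... | true  = W , set-≡ D u W , ≤-refl
  ... | false = not-improving W D eq

  relax-reached : ∀ {u v x} a (tr : Traverses o (lookup E a) u v) D →
                  Reached D v x → Reached (relax a tr D) u (lookup cost a + x)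
  relax-reached a tr D (W , eq , W≤x) rewrite eq with improve-reached (step a tr W) D
  ... | W′ , eq′ , W′≤ = W′ , eq′ , ≤-trans W′≤ (+-monoʳ-≤ _ W≤x)

  ≼-relax : ∀ {u v} a (tr : Traverses o (lookup E a) u v) D → D ≼ relax a tr D
  ≼-relax {v = v} a tr D = ≼-improve (Maybe.map (step a tr) (D v)) D

  ≼-relaxArc : ∀ a D → D ≼ relaxArc a D
  ≼-relaxArc a D r with reversal o (lookup E a)
  ... | nothing = ≼-relax a (forward o (lookup E a)) D r
  ... | just tr = ≼-relax a tr (relaxForward a D) (≼-relax a (forward o (lookup E a)) D r)

  ≼-relaxArcs : ∀ {j} (g : Fin j → Fin m) D → D ≼ relaxArcs g D
  ≼-relaxArcs {zero}  g D r = r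
  ≼-relaxArcs {suc j} g D r = ≼-relaxArcs (g ∘ suc) _ (≼-relaxArc (g zero) D r)

  -- The labels to which paths are extended are labels of suffixes, so a
  -- strict improvement cannot close a cycle.
  Closed : Labels → ∀ {u} → Walk o E u t → Set ℓ₂
  Closed D {u} []            = Reached D u 0#
  Closed D {u} (step a tr W) = Reached D u (walkCost cost (step a tr W)) × Closed D W

  Closed-≼ : ∀ {D D′} → D ≼ D′ → ∀ {u} (W : Walk o E u t) → Closed D W → Closed D′ W
  Closed-≼ D≼D′ []            r       = D≼D′ r
  Closed-≼ D≼D′ (step a tr W) (r , c) = D≼D′ r , Closed-≼ D≼D′ W c

  record Sound (D : Labels) : Set ℓ₂ where
    field
      path   : ∀ {u W} → D u ≡ just W → IsPath W
      closed : ∀ {u W} → D u ≡ just W → Closed D W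

  open Sound

  module _ (cost≥0 : NonNegative cost) where

    -- The suffix of the walk that starts at `x` costs no more than the whole walk, because costs
    -- are nonnegative.
    Closed⇒reached : ∀ {D u} (W : Walk o E u t) → Closed D W →
                     ∀ {x} → x List.∈ tails W ++ t ∷ [] → Reached D x (walkCost cost W)
    Closed⇒reached []            r       (here refl) = r
    Closed⇒reached (step a tr W) (r , _) (here refl) = r
    Closed⇒reached (step a tr W) (_ , c) (there x∈W) with Closed⇒reached W c x∈W
    ... | W′ , eq , W′≤W = W′ , eq , ≤-trans W′≤W (x≤z+x (cost≥0 a))

    Sound-improve : ∀ {u v} a (tr : Traverses o (lookup E a) u v) W D →
                    Sound D → D v ≡ just W → Sound (improve (just (step a tr W)) D)
    Sound-improve {u} a tr W D sound eq with improves (step a tr W) (D u) in imp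
    ... | false = sound
    ... | true  = record { path = path′ ; closed = closed′ }
      where
      -- A vertex `u` on `W` would already carry a label no dearer than `W`, and the improvement
      -- could not be strict.
      fresh : ¬ u List.∈ tails W ++ t ∷ []
      fresh u∈W with Closed⇒reached W (closed sound eq) u∈W
      ... | W₀ , eq₀ , W₀≤W =
        improving (step a tr W) D imp (W₀ , eq₀ , ≤-trans W₀≤W (x≤z+x (cost≥0 a)))
      path′ : ∀ {x W′} → set D u (step a tr W) x ≡ just W′ → IsPath W′
      path′ {x} eq′ with x ≟ u
      path′ refl | yes refl = ¬Any⇒All¬ _ fresh ∷ path sound eq
      path′ eq′  | no _     = path sound eq′
      closed′ : ∀ {x W′} → set D u (step a tr W) x ≡ just W′ → Closed (set D u (step a tr W)) W′
      closed′ {x} eq′ with x ≟ u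
      closed′ eq′  | no _     = Closed-≼ (≼-set _ D imp) _ (closed sound eq′)
      closed′ refl | yes refl =
        (_ , set-≡ D u _ , ≤-refl) , Closed-≼ (≼-set _ D imp) W (closed sound eq)

    Sound-relax : ∀ {u v} a (tr : Traverses o (lookup E a) u v) {D} → Sound D → Sound (relax a tr D)
    Sound-relax {v = v} a tr {D} sound with D v in eq
    ... | nothing = sound
    ... | just W  = Sound-improve a tr W D sound eq

    Sound-relaxArc : ∀ a {D} → Sound D → Sound (relaxArc a D)
    Sound-relaxArc a sound with reversal o (lookup E a)
    ... | nothing = Sound-relax a _ sound
    ... | just tr = Sound-relax a tr (Sound-relax a _ sound)

    Sound-relaxArcs : ∀ {j} (g : Fin j → Fin m) {D} → Sound D → Sound (relaxArcs g D)
    Sound-relaxArcs {zero}  g sound = sound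
    Sound-relaxArcs {suc j} g sound = Sound-relaxArcs (g ∘ suc) (Sound-relaxArc (g zero) sound)

    Sound-relaxTimes : ∀ i {D} → Sound D → Sound (relaxTimes i D)
    Sound-relaxTimes zero    sound = sound
    Sound-relaxTimes (suc i) sound = Sound-relaxTimes i (Sound-relaxArcs (λ a → a) sound)

    Sound-initial : Sound initial
    Sound-initial = record { path = path′ ; closed = closed′ }
      where
      path′ : ∀ {x W} → initial x ≡ just W → IsPath W
      path′ {x} eq with x ≟ t
      path′ refl | yes refl = [] ∷ []
      closed′ : ∀ {x W} → initial x ≡ just W → Closed initial W
      closed′ {x} eq with x ≟ t
      closed′ refl | yes refl = [] , set-≡ _ t [] , ≤-refl

  covers : ∀ o′ (e : Fin n × Fin n) {u v} → Traverses o′ e u v →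
           (u ≡ proj₁ e × v ≡ proj₂ e) ⊎
           (∃[ tr ] reversal o′ e ≡ just tr × u ≡ proj₂ e × v ≡ proj₁ e)
  covers directed   e refl        = inj₁ (refl , refl)
  covers undirected e (inj₁ refl) = inj₁ (refl , refl)
  covers undirected e (inj₂ refl) = inj₂ (_ , refl , refl , refl)

  relaxArc-reached : ∀ {u v x} a → Traverses o (lookup E a) u v → ∀ D →
                     Reached D v x → Reached (relaxArc a D) u (lookup cost a + x)
  relaxArc-reached a tr D r with covers o (lookup E a) tr
  ... | inj₂ (tr′ , eq , refl , refl) rewrite eq =
    relax-reached a tr′ (relaxForward a D) (≼-relax a (forward o (lookup E a)) D r)
  ... | inj₁ (refl , refl) with reversal o (lookup E a)
  ...   | nothing  = relax-reached a (forward o (lookup E a)) D r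
  ...   | just tr′ = ≼-relax a tr′ (relaxForward a D) (relax-reached a (forward o (lookup E a)) D r)

  relaxArcs-reached : ∀ {j u v x} (g : Fin j → Fin m) i → Traverses o (lookup E (g i)) u v → ∀ D →
                      Reached D v x → Reached (relaxArcs g D) u (lookup cost (g i) + x)
  relaxArcs-reached g zero    tr D r = ≼-relaxArcs (g ∘ suc) _ (relaxArc-reached (g zero) tr D r)
  relaxArcs-reached g (suc i) tr D r =
    relaxArcs-reached (g ∘ suc) i tr _ (≼-relaxArc (g zero) D r)

  -- The invariant after `i` rounds. It speaks of walks, so the induction does not have to carry the
  -- path condition.
  BelowWalks : ℕ → Labels → Set ℓ₂
  BelowWalks i D = ∀ {u} (W : Walk o E u t) → length (arcs W) ℕ.≤ i → Reached D u (walkCost cost W)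

  BelowWalks-relaxArcs : ∀ {i D} → BelowWalks i D → BelowWalks (suc i) (relaxArcs (λ a → a) D)
  BelowWalks-relaxArcs {D = D} below []            _         = ≼-relaxArcs (λ a → a) D (below [] z≤n)
  BelowWalks-relaxArcs {D = D} below (step a tr W) (s≤s len) =
    relaxArcs-reached (λ a → a) a tr D (below W len)

  BelowWalks-relaxTimes : ∀ k {i D} → BelowWalks i D → BelowWalks (k ℕ.+ i) (relaxTimes k D)
  BelowWalks-relaxTimes zero          below = below
  BelowWalks-relaxTimes (suc k) {i} {D} below =
    subst (λ l → BelowWalks l (relaxTimes (suc k) D)) (ℕ.+-suc k i)
      (BelowWalks-relaxTimes k (BelowWalks-relaxArcs below))

  BelowWalks-initial : BelowWalks 0 initial
  BelowWalks-initial [] _ = [] , set-≡ _ t [] , ≤-refl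

  length-arcs : ∀ {u v} (W : Walk o E u v) → length (arcs W) ≡ length (tails W)
  length-arcs []            = refl
  length-arcs (step a tr W) = cong suc (length-arcs W)

  -- The vertices of a path are distinct. The bound is generous by one and matches the `n` rounds of
  -- `final`.
  path-length : ∀ {u v} (W : Walk o E u v) → IsPath W → length (arcs W) ℕ.≤ n
  path-length {v = v} W path = begin
    length (arcs W)             ≡⟨ length-arcs W ⟩
    length (tails W)            ≤⟨ ℕ.m≤m+n _ 1 ⟩
    length (tails W) ℕ.+ 1      ≡⟨ length-++ (tails W) ⟨
    length (tails W ++ v ∷ [])  ≤⟨ length-unique path ⟩
    n                           ∎
    where open ℕ.≤-Reasoning

  final : Labels
  final = relaxTimes n initial

  final-reached : ∀ {u} (W : Walk o E u t) → IsPath W → Reached final u (walkCost cost W)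
  final-reached W path =
    BelowWalks-relaxTimes n BelowWalks-initial W (ℕ.≤-trans (path-length W path) (ℕ.m≤m+n n 0))

  answer : Maybe (Walk o E s t) → Value
  answer nothing  = nil
  answer (just W) = nil ∙ subset (arcSet W)

  answer-solves : NonNegative cost → SolvesShortestPath o N (answer (final s))
  answer-solves cost≥0 with final s in eq
  ... | nothing = inj₂ (no-path , refl)
    where
    no-path : ¬ (Σ[ W ∈ Walk o E s t ] IsPath W)
    no-path (W , path) with final-reached W path
    ... | W′ , eq′ , _ with trans (sym eq) eq′
    ...   | ()
  ... | just W = inj₁ (W , (Sound.path (Sound-relaxTimes cost≥0 n (Sound-initial cost≥0)) eq , shortest) , refl)
    where
    shortest : ∀ (W′ : Walk o E s t) → IsPath W′ → walkCost cost W ≤ walkCost cost W′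
    shortest W′ path with final-reached W′ path
    ... | W″ , eq′ , W″≤W′ with trans (sym eq) eq′
    ...   | refl = W″≤W′

  module _ {M : ℕ} (n≤M : n ℕ.≤ M) (m≤M : m ℕ.≤ M) where

    set-returns : ∀ u (W : Walk o E u t) D →
                  Call update# (fin u ∙ labels D ∙ label (just W)) (labels (set D u W)) (50 * suc M) []
    set-returns u W D = within (linear≤ n≤M)
      (update-returns u _ _ (cong label (sym (set-≡ D u W))) λ x x≢u → cong label (sym (set-≢ D u W x≢u)))

    label-returns : ∀ u D → Call lookup# (fin u ∙ labels D) (label (D u)) (50 * suc M) []
    label-returns u D = within (linear≤ n≤M) (lookup-returns u (label ∘ D))

    insert-returns : ∀ a (p : Subset m) →
                     Call update# (fin a ∙ subset p ∙ bool true) (subset (⁅ a ⁆ ∪ p)) (50 * suc M) []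
    insert-returns a p = argument (cong (λ v → fin a ∙ v ∙ bool true) (sym (vec-list bool p)))
      (result (sym (vec-list bool (⁅ a ⁆ ∪ p))) (within (linear≤ m≤M)
        (update-returns a _ _ (cong bool (sym (lookup-insert a p)))
          λ x x≢a → cong bool (sym (lookup-insert-≢ p x≢a)))))

    relax-returns : ∀ {u v} a (tr : Traverses o (lookup E a) u v) D →
                    Call relax# ((fin u ∙ fin v) ∙ (fin a ∙ num (lookup cost a)) ∙ labels D)
                         (labels (relax a tr D)) (500 * suc M) []
    relax-returns {u} {v} a tr D with D v in eq
    ... | nothing = bounded M 500
      (let# (subcall 50 simple (result (cong label eq) (label-returns v D)) ℕ.≤-refl)
      (then# simple simple))
    ... | just W = result (choice (step a tr W) D) (bounded M 500
      (let# (subcall 50 simple (result (cong label eq) (label-returns v D)) ℕ.≤-refl)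
      (else# simple
      (let# (simple ⊕ subcall 50 simple (insert-returns a (arcSet W)) ℕ.≤-refl)
      (let# (subcall 50 simple (label-returns u D) ℕ.≤-refl)
      (let# (subcall 50 simple (set-returns u (step a tr W) D) ℕ.≤-refl) simple))))))
      where
      choice : ∀ {u} (W : Walk o E u t) D →
               if-nil-then (label (D u)) (labels (set D u W))
                 (if-nil-then (⟦ leq ⟧₂ (⟦ hd ⟧₁ (label (D u))) (num (walkCost cost W)))
                   (labels (set D u W)) (labels D))
               ≡ labels (improve (just W) D)
      choice {u} W D with D u
      ... | nothing = refl
      ... | just W₀ with walkCost cost W₀ ≤? walkCost cost W
      ...   | yes _ = refl
      ...   | no _  = refl

-- Running time of the shortest path program

module _ {a ℓ₁ ℓ₂ : Level} (K : OrderedAbelianGroup a ℓ₁ ℓ₂) where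

  open OrderedAbelianGroup K using (Carrier)
  open Costs K
  open Semantics K

  edge : ∀ {n} → Fin n × Fin n → Value
  edge (u , v) = fin u ∙ fin v

  -- Stated apart from `Labelling` so that the orientation can be matched on: `relaxEdge` and
  -- `reversal` compute only for a given orientation.
  relaxEdge-returns :
    ∀ (o : Orientation) (N : Network) →
    let open Network N in let open Labelling K o N in let open Derivations none o in
    ∀ {M} → n ℕ.≤ M → m ℕ.≤ M → ∀ a D →
    Call relaxEdge# (edge (lookup E a) ∙ (fin a ∙ num (lookup cost a)) ∙ labels D)
         (labels (relaxArc a D)) (1100 * suc M) []
  relaxEdge-returns directed N {M} n≤M m≤M a D =
    bounded M 1100 (subcall 500 simple (relax-returns n≤M m≤M a refl D) ℕ.≤-refl)
    where
    open Labelling K directed N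
    open Derivations none directed
  relaxEdge-returns undirected N {M} n≤M m≤M a D =
    bounded M 1100 (subcall 500
      (simple ⊕ simple ⊕ subcall 500 simple (relax-returns n≤M m≤M a (inj₁ refl) D) ℕ.≤-refl)
      (relax-returns n≤M m≤M a (inj₂ refl) _) ℕ.≤-refl)
    where
    open Labelling K undirected N
    open Derivations none undirected

  size-nat : ∀ n → n ℕ.≤ size (nat n)
  size-nat zero    = z≤n
  size-nat (suc n) = s≤s (ℕ.m≤n⇒m≤1+n (size-nat n))

  size-vec : ∀ {b} {A : Set b} (f : A → Value) {j} (xs : Vec A j) → j ℕ.≤ size (vec f xs)
  size-vec f []       = z≤n
  size-vec f (x ∷ xs) = s≤s (ℕ.≤-trans (size-vec f xs) (ℕ.m≤n+m _ (size (f x))))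

  n≤size : ∀ N → Network.n N ℕ.≤ size ⌜ N ⌝
  n≤size N = ℕ.m≤n⇒m≤1+n (ℕ.≤-trans (size-nat (Network.n N)) (ℕ.m≤m+n _ _))

  m≤size : ∀ N → Network.m N ℕ.≤ size ⌜ N ⌝
  m≤size N = ℕ.m≤n⇒m≤1+n (ℕ.≤-trans
    (ℕ.m≤n⇒m≤1+n (ℕ.≤-trans (size-vec edge (Network.E N)) (ℕ.m≤m+n _ _)))
    (ℕ.m≤n+m _ (size (nat (Network.n N)))))

  module ShortestPathRun (o : Orientation) (N : Network) {M : ℕ}
                         (n≤M : Network.n N ℕ.≤ M) (m≤M : Network.m N ℕ.≤ M) where

    open Network N
    open Labelling K o N
    open Derivations none o

    -- The recursion runs through the suffixes of the arc list. Here `g` embeds the suffix that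
    -- starts at arc number `p`, and the program counts `p` along because labels record arcs by
    -- number.
    relaxArcs-returns : ∀ {j} (g : Fin j → Fin m) p → (∀ i → toℕ (g i) ≡ p ℕ.+ toℕ i) → ∀ D →
                        Call relaxAll# (list (edge ∘ lookup E ∘ g) ∙ list (num ∘ lookup cost ∘ g) ∙ nat p ∙ labels D)
                             (labels (relaxArcs g D)) (suc j * (1200 * suc M)) []
    relaxArcs-returns {zero}  g p eq D = base-case M 0 1200 (then# simple simple)
    relaxArcs-returns {suc j} g p eq D = step-case M (suc j) 1200 refl
      (else# simple (recurse
        (simple ⊕ simple ⊕ simple ⊕
          subcall 1100 simple
            (argument (cong (λ p → edge (lookup E (g zero)) ∙ (nat p ∙ num (lookup cost (g zero))) ∙ labels D)
                        (trans (eq zero) (ℕ.+-identityʳ p)))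
              (relaxEdge-returns o N n≤M m≤M (g zero) D)) ℕ.≤-refl)
        (relaxArcs-returns (g ∘ suc) (suc p) (λ i → trans (eq (suc i)) (ℕ.+-suc p (toℕ i))) _)))

    M² : ℕ
    M² = M ℕ.+ M * suc M

    relaxTimes-returns : ∀ i D →
                         Call rounds# (nat i ∙ (ends E ∙ vec num cost) ∙ labels D)
                              (labels (relaxTimes i D)) (suc i * (1300 * suc M²)) []
    relaxTimes-returns zero    D = base-case M² 0 1300 (then# simple simple)
    relaxTimes-returns (suc i) D = step-case M² (suc i) 1300 refl
      (else# simple (recurse
        (simple ⊕ simple ⊕
          subcall 1200 simple
            (argument (cong₂ (λ v w → v ∙ w ∙ nil ∙ labels D)
                        (sym (vec-list edge E)) (sym (vec-list num cost)))
              (relaxArcs-returns (λ a → a) 0 (λ _ → refl) D))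
            (repeat≤ {m} {M} 1200 M m≤M))
        (relaxTimes-returns i _)))

    M³ : ℕ
    M³ = M² ℕ.+ M * suc M²

    -- A numeral is a list of that many `nil`s, so `blank#` applied to the number of vertices yields
    -- one empty label for each vertex.
    nat-list : ∀ j → nat j ≡ list {j} (λ _ → nil)
    nat-list zero    = refl
    nat-list (suc j) = cong (nil ∙_) (nat-list j)

    empty-returns : Call blank# (ends E) (subset (⊥ {m})) (50 * suc M) []
    empty-returns = argument (sym (vec-list edge E))
      (result (sym (trans (vec-list bool (⊥ {m})) (list-cong λ i → cong bool (lookup-replicate i false))))
        (within (linear≤ m≤M) (blank-returns (edge ∘ lookup E))))

    unlabelled-returns : Call blank# (nat n) (labels (λ _ → nothing)) (50 * suc M) []
    unlabelled-returns = argument (sym (nat-list n)) (within (linear≤ n≤M) (blank-returns _))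

    lift≤ : ∀ C → C * suc M ℕ.≤ C * suc M³
    lift≤ C = ℕ.*-monoʳ-≤ C (s≤s (ℕ.≤-trans (ℕ.m≤m+n M _) (ℕ.m≤m+n M² _)))

    main-returns : ∃[ time ] Run (shortestPathProgram o) ⌜ N ⌝ (answer (final s)) time ×
                             time ℕ.≤ 2000 * suc M³
    main-returns = subst (λ v → ∃[ time ] Run (shortestPathProgram o) ⌜ N ⌝ v time × time ℕ.≤ 2000 * suc M³)
      output
      (bounded-eval M³ 2000
        (let# (subcall 50 (simple ⊕ subcall 50 simple unlabelled-returns (lift≤ 50) ⊕
                           simple ⊕ subcall 50 simple empty-returns (lift≤ 50))
                (set-returns n≤M m≤M t [] _) (lift≤ 50))
        (let# (subcall 1300 simple (relaxTimes-returns n initial) (repeat≤ {n} {M} 1300 M² n≤M))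
        (let# (subcall 50 simple (label-returns n≤M m≤M s final) (lift≤ 50)) simple))))
      where
      output : if-nil-then (label (final s)) nil (nil ∙ ⟦ tl ⟧₁ (label (final s))) ≡ answer (final s)
      output with final s
      ... | nothing = refl
      ... | just W  = refl

  size>0 : ∀ v → 1 ℕ.≤ size v
  size>0 nil     = s≤s z≤n
  size>0 (num _) = s≤s z≤n
  size>0 (_ ∙ _) = s≤s z≤n

  cube≤ : ∀ C {M} → 1 ℕ.≤ M → C * (suc M * (suc M * suc M)) ℕ.≤ C * 8 * M ^ 3
  cube≤ C {M} M>0 = begin
    C * (suc M * (suc M * suc M))  ≤⟨ ℕ.*-monoʳ-≤ C (ℕ.*-mono-≤ sucM≤ (ℕ.*-mono-≤ sucM≤ sucM≤)) ⟩
    C * (2 * M * (2 * M * (2 * M)))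
      ≡⟨ solve 2 (λ c x → c :* (con 2 :* x :* (con 2 :* x :* (con 2 :* x))) :=
                          c :* con 8 :* (x :* (x :* (x :* con 1)))) refl C M ⟩
    C * 8 * M ^ 3                  ∎
    where
    open ℕ.≤-Reasoning
    open +-*-Solver
    sucM≤ : suc M ℕ.≤ 2 * M
    sucM≤ = ℕ.+-mono-≤ M>0 (ℕ.m≤m+n M 0)

  shortestPath-correct : ∀ o → ShortestPathAlgorithm o (shortestPathProgram o)
  shortestPath-correct o = 2000 * 8 , 3 , λ N cost≥0 →
    let time , run , time≤ = ShortestPathRun.main-returns o N (n≤size N) (m≤size N)
    in _ , time , run , Labelling.answer-solves K o N cost≥0 , ℕ.≤-trans time≤ (cube≤ 2000 (size>0 ⌜ N ⌝))

-- Subgraphs given by a mask, and walks in them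

member : ∀ {m} (p : Subset m) {x} → lookup p x ≡ true → x ∈ p
member p {x} = lookup⇒[]= x p

embed : ∀ {m} (p : Subset m) → Fin ∣ p ∣ → Fin m
embed (true  ∷ p) zero    = zero
embed (true  ∷ p) (suc j) = suc (embed p j)
embed (false ∷ p) j       = suc (embed p j)

compress : ∀ {a m} {A : Set a} (p : Subset m) → Vec A m → Vec A ∣ p ∣
compress []          []       = []
compress (true  ∷ p) (x ∷ xs) = x ∷ compress p xs
compress (false ∷ p) (x ∷ xs) = compress p xs

lookup-compress : ∀ {a m} {A : Set a} (p : Subset m) (xs : Vec A m) j →
                  lookup (compress p xs) j ≡ lookup xs (embed p j)
lookup-compress (true  ∷ p) (x ∷ xs) zero    = refl
lookup-compress (true  ∷ p) (x ∷ xs) (suc j) = lookup-compress p xs j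
lookup-compress (false ∷ p) (x ∷ xs) j       = lookup-compress p xs j

compress-⊑ : ∀ {a m} {A : Set a} (p : Subset m) (xs : Vec A m) →
             Vec.toList (compress p xs) ⊑ Vec.toList xs
compress-⊑ []          []       = []
compress-⊑ (true  ∷ p) (x ∷ xs) = refl ∷ compress-⊑ p xs
compress-⊑ (false ∷ p) (x ∷ xs) = x ∷ʳ compress-⊑ p xs

embed-∈ : ∀ {m} (p : Subset m) j → embed p j ∈ p
embed-∈ (true  ∷ p) zero    = here
embed-∈ (true  ∷ p) (suc j) = there (embed-∈ p j)
embed-∈ (false ∷ p) j       = there (embed-∈ p j)

embed-surjective : ∀ {m} (p : Subset m) {x} → x ∈ p → ∃[ j ] embed p j ≡ x
embed-surjective (true  ∷ p) here        = zero , refl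
embed-surjective (true  ∷ p) (there x∈p) with embed-surjective p x∈p
... | j , eq = suc j , cong suc eq
embed-surjective (false ∷ p) (there x∈p) with embed-surjective p x∈p
... | j , eq = j , cong suc eq

-- The union of `r` with the image of `q` under `embed p`, in one pass: it adds a path found in a
-- subgraph to a set of arcs of the whole graph.
expand : ∀ {m} (p : Subset m) → Subset ∣ p ∣ → Subset m → Subset m
expand []          q       r       = []
expand (true  ∷ p) (c ∷ q) (b ∷ r) = (c ∨ b) ∷ expand p q r
expand (false ∷ p) q       (b ∷ r) = b ∷ expand p q r

∈-expand⁻ : ∀ {m} (p : Subset m) q r {x} → x ∈ expand p q r →
            (∃[ j ] j ∈ q × embed p j ≡ x) ⊎ x ∈ r
∈-expand⁻ (true  ∷ p) (true  ∷ q) (b ∷ r)     here = inj₁ (zero , here , refl)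
∈-expand⁻ (true  ∷ p) (false ∷ q) (true ∷ r)  here = inj₂ here
∈-expand⁻ (true  ∷ p) (c ∷ q)     (b ∷ r) (there x∈) with ∈-expand⁻ p q r x∈
... | inj₁ (j , j∈q , eq) = inj₁ (suc j , there j∈q , cong suc eq)
... | inj₂ x∈r            = inj₂ (there x∈r)
∈-expand⁻ (false ∷ p) q (true ∷ r) here       = inj₂ here
∈-expand⁻ (false ∷ p) q (b ∷ r)    (there x∈) with ∈-expand⁻ p q r x∈
... | inj₁ (j , j∈q , eq) = inj₁ (j , j∈q , cong suc eq)
... | inj₂ x∈r            = inj₂ (there x∈r)

∈-expand⁺ˡ : ∀ {m} (p : Subset m) {q} r {j} → j ∈ q → embed p j ∈ expand p q r
∈-expand⁺ˡ (true  ∷ p) (b ∷ r) here        = here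
∈-expand⁺ˡ (true  ∷ p) (b ∷ r) (there j∈q) = there (∈-expand⁺ˡ p r j∈q)
∈-expand⁺ˡ (false ∷ p) (b ∷ r) j∈q         = there (∈-expand⁺ˡ p r j∈q)

∈-expand⁺ʳ : ∀ {m} (p : Subset m) q {r x} → x ∈ r → x ∈ expand p q r
∈-expand⁺ʳ (true  ∷ p) (true  ∷ q) here        = here
∈-expand⁺ʳ (true  ∷ p) (false ∷ q) here        = here
∈-expand⁺ʳ (true  ∷ p) (c ∷ q)     (there x∈r) = there (∈-expand⁺ʳ p q x∈r)
∈-expand⁺ʳ (false ∷ p) q           here        = here
∈-expand⁺ʳ (false ∷ p) q           (there x∈r) = there (∈-expand⁺ʳ p q x∈r)

∈-⋃⁻ : ∀ {m} (as : List (Fin m)) {x} → x ∈ ⋃ (List.map ⁅_⁆ as) → x List.∈ as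
∈-⋃⁻ []       x∈ = contradiction x∈ ∉⊥
∈-⋃⁻ (a ∷ as) x∈ with x∈p∪q⁻ ⁅ a ⁆ _ x∈
... | inj₁ x∈a  = here (x∈⁅y⁆⇒x≡y a x∈a)
... | inj₂ x∈as = there (∈-⋃⁻ as x∈as)

∈-⋃⁺ : ∀ {m} {as : List (Fin m)} {x} → x List.∈ as → x ∈ ⋃ (List.map ⁅_⁆ as)
∈-⋃⁺ (here refl) = x∈p∪q⁺ (inj₁ (x∈⁅x⁆ _))
∈-⋃⁺ (there x∈)  = x∈p∪q⁺ (inj₂ (∈-⋃⁺ x∈))

module _ {o : Orientation} {n m : ℕ} {E : Ends n m} where

  expandWalk : ∀ p {u v} → Walk o (compress p E) u v → Walk o E u v
  expandWalk p []            = []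
  expandWalk p (step j tr W) =
    step (embed p j) (subst (λ e → Traverses o e _ _) (lookup-compress p E j) tr) (expandWalk p W)

  tails-expandWalk : ∀ p {u v} (W : Walk o (compress p E) u v) → tails (expandWalk p W) ≡ tails W
  tails-expandWalk p []                   = refl
  tails-expandWalk p (step {u = u} _ _ W) = cong (u ∷_) (tails-expandWalk p W)

  IsPath-expandWalk : ∀ p {u v} (W : Walk o (compress p E) u v) → IsPath W → IsPath (expandWalk p W)
  IsPath-expandWalk p {v = v} W path rewrite tails-expandWalk p W = path

  arcs-expandWalk : ∀ p {u v} (W : Walk o (compress p E) u v) →
                    arcs (expandWalk p W) ≡ List.map (embed p) (arcs W)
  arcs-expandWalk p []            = refl
  arcs-expandWalk p (step j tr W) = cong (embed p j ∷_) (arcs-expandWalk p W)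

  ∈-expandWalk : ∀ p {u v} (W : Walk o (compress p E) u v) {x} → x ∈ arcSet (expandWalk p W) →
                 ∃[ j ] j ∈ arcSet W × embed p j ≡ x
  ∈-expandWalk p W x∈ with ∈-map⁻ (embed p) (subst (_ List.∈_) (arcs-expandWalk p W) (∈-⋃⁻ (arcs (expandWalk p W)) x∈))
  ... | j , j∈ , eq = j , ∈-⋃⁺ j∈ , sym eq

  expand-arcSet : ∀ p {u v} (W : Walk o (compress p E) u v) r →
                  expand p (arcSet W) r ≡ arcSet (expandWalk p W) ∪ r
  expand-arcSet p W r = ⊆-antisym there-way back-way
    where
    there-way : expand p (arcSet W) r ⊆ arcSet (expandWalk p W) ∪ r
    there-way x∈ with ∈-expand⁻ p (arcSet W) r x∈
    ... | inj₂ x∈r             = x∈p∪q⁺ (inj₂ x∈r)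
    ... | inj₁ (j , j∈ , refl) = x∈p∪q⁺ (inj₁ (∈-⋃⁺
      (subst (_ List.∈_) (sym (arcs-expandWalk p W)) (∈-map⁺ (embed p) (∈-⋃⁻ (arcs W) j∈)))))
    back-way : arcSet (expandWalk p W) ∪ r ⊆ expand p (arcSet W) r
    back-way x∈ with x∈p∪q⁻ (arcSet (expandWalk p W)) r x∈
    ... | inj₂ x∈r = ∈-expand⁺ʳ p (arcSet W) x∈r
    ... | inj₁ x∈W with ∈-expandWalk p W x∈W
    ...   | j , j∈ , refl = ∈-expand⁺ˡ p r j∈

  restrictWalk : ∀ p {u v} (W : Walk o E u v) → (∀ {x} → x List.∈ arcs W → x ∈ p) →
                 Σ[ W′ ∈ Walk o (compress p E) u v ]
                   tails W′ ≡ tails W × List.map (embed p) (arcs W′) ≡ arcs W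
  restrictWalk p []                    ⊆p = [] , refl , refl
  restrictWalk p (step {u} a tr W) ⊆p with embed-surjective p (⊆p (here refl)) | restrictWalk p W (⊆p ∘ there)
  ... | j , refl | W′ , eq , eq′ =
    step j (subst (λ e → Traverses o e _ _) (sym (lookup-compress p E j)) tr) W′ ,
    cong (u ∷_) eq , cong (embed p j ∷_) eq′

  source-∈ : ∀ {u v} (W : Walk o E u v) → u List.∈ tails W ++ v ∷ []
  source-∈ []           = here refl
  source-∈ (step _ _ W) = here refl

  shared-end : ∀ o′ (e : Fin n × Fin n) {u v u′ v′} →
               Traverses o′ e u v → Traverses o′ e u′ v′ → u ≡ u′ ⊎ u ≡ v′
  shared-end directed   e refl        refl        = inj₁ refl
  shared-end undirected e (inj₁ refl) (inj₁ refl) = inj₁ refl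
  shared-end undirected e (inj₁ refl) (inj₂ refl) = inj₂ refl
  shared-end undirected e (inj₂ refl) (inj₁ refl) = inj₂ refl
  shared-end undirected e (inj₂ refl) (inj₂ refl) = inj₁ refl

  -- The reason why a path repeats no arc: traversed a second time, in either direction, the arc
  -- would bring back its first vertex.
  end-∈ : ∀ {u x v w a} (W : Walk o E v w) → a List.∈ arcs W →
          Traverses o (lookup E a) u x → u List.∈ tails W ++ w ∷ []
  end-∈ (step a tr′ W) (there a∈W) tr = there (end-∈ W a∈W tr)
  end-∈ (step a tr′ W) (here refl) tr with shared-end o (lookup E a) tr tr′
  ... | inj₁ refl = here refl
  ... | inj₂ refl = there (source-∈ W)

-- Costs of arc sets

module SetCosts {a ℓ₁ ℓ₂ : Level} (K : OrderedAbelianGroup a ℓ₁ ℓ₂) where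

  open OrderedGroupProperties K
  open Costs K
  open import Algebra.Properties.CommutativeMonoid.Sum commutativeMonoid using (sum; ∑-distrib-+)
  open import Relation.Binary.Reasoning.PartialOrder poset

  sum-mono : ∀ {m} {f g : Fin m → Carrier} → (∀ i → f i ≤ g i) → sum f ≤ sum g
  sum-mono {zero}  f≤g = ≤-refl
  sum-mono {suc m} f≤g = +-mono-≤ (f≤g zero) (sum-mono (f≤g ∘ suc))

  infix 8 _on_
  _on_ : Carrier → Bool → Carrier
  x on b = if b then x else 0#

  setCost-sub : ∀ {m} (c : Vec Carrier m) (P B Q : Subset m) →
                (∀ e → lookup c e on lookup Q e ≤ lookup c e on lookup P e + lookup c e on lookup B e) →
                setCost c Q ≤ setCost c P + setCost c B
  setCost-sub c P B Q hyp = begin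
    setCost c Q                                                    ≤⟨ sum-mono hyp ⟩
    sum (λ e → lookup c e on lookup P e + lookup c e on lookup B e)
      ≈⟨ ∑-distrib-+ (λ e → lookup c e on lookup P e) (λ e → lookup c e on lookup B e) ⟩
    setCost c P + setCost c B                                      ∎

  setCost-super : ∀ {m} (c : Vec Carrier m) (P B Q : Subset m) →
                  (∀ e → lookup c e on lookup P e + lookup c e on lookup B e ≤ lookup c e on lookup Q e) →
                  setCost c P + setCost c B ≤ setCost c Q
  setCost-super c P B Q hyp = begin
    setCost c P + setCost c B
      ≈⟨ ∑-distrib-+ (λ e → lookup c e on lookup P e) (λ e → lookup c e on lookup B e) ⟨
    sum (λ e → lookup c e on lookup P e + lookup c e on lookup B e)  ≤⟨ sum-mono hyp ⟩
    setCost c Q                                                      ∎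

  setCost-⊥ : ∀ {m} (c : Vec Carrier m) → setCost c ⊥ ≈ 0#
  setCost-⊥ []      = ≈-refl
  setCost-⊥ (x ∷ c) = ≈-trans (identityˡ _) (setCost-⊥ c)

  setCost-⁅⁆ : ∀ {m} (c : Vec Carrier m) e → setCost c ⁅ e ⁆ ≈ lookup c e
  setCost-⁅⁆ (x ∷ c) zero    = ≈-trans (+-congˡ (setCost-⊥ c)) (identityʳ x)
  setCost-⁅⁆ (x ∷ c) (suc e) = ≈-trans (identityˡ _) (setCost-⁅⁆ c e)

  -- Arcs of cost zero may be shared.
  setCost-∪-≥ : ∀ {m} (c : Vec Carrier m) P B → (∀ e → e ∈ P → e ∈ B → lookup c e ≤ 0#) →
                setCost c P + setCost c B ≤ setCost c (P ∪ B)
  setCost-∪-≥ c P B disjoint = setCost-super c P B (P ∪ B) λ e →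
    subst (λ b → lookup c e on lookup P e + lookup c e on lookup B e ≤ lookup c e on b)
      (sym (lookup-zipWith _∨_ e P B)) (pointwise e)
    where
    pointwise : ∀ e → lookup c e on lookup P e + lookup c e on lookup B e
                      ≤ lookup c e on (lookup P e ∨ lookup B e)
    pointwise e with lookup P e in eqP | lookup B e in eqB
    ... | false | _     = ≤-reflexive (identityˡ _)
    ... | true  | false = ≤-reflexive (identityʳ _)
    ... | true  | true  = begin
      lookup c e + lookup c e  ≤⟨ +-monoˡ-≤ _ (disjoint e (member P eqP) (member B eqB)) ⟩
      0# + lookup c e          ≈⟨ identityˡ _ ⟩
      lookup c e               ∎

  -- The arcs of a path are distinct, so no cost is lost when the list of arcs becomes a set.
  walkCost≤setCost : ∀ {m} (c : Vec Carrier m) {o n} {E : Ends n m} {u v} (W : Walk o E u v) → IsPath W →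
                     walkCost c W ≤ setCost c (arcSet W)
  walkCost≤setCost c []            path           = ≤-reflexive (≈-sym (setCost-⊥ c))
  walkCost≤setCost c (step a tr W) (fresh ∷ path) = ≤-trans
    (+-mono-≤ (≤-reflexive (≈-sym (setCost-⁅⁆ c a))) (walkCost≤setCost c W path))
    (setCost-∪-≥ c ⁅ a ⁆ (arcSet W) λ e e∈a e∈W →
      contradiction (end-∈ W (∈-⋃⁻ (arcs W) (subst (_∈ arcSet W) (x∈⁅y⁆⇒x≡y a e∈a) e∈W)) tr)
                    (All¬⇒¬Any fresh))

  module _ {m : ℕ} (c : Vec Carrier m) (c≥0 : NonNegative c) where

    setCost-mono : ∀ {P Q} → P ⊆ Q → setCost c P ≤ setCost c Q
    setCost-mono {P} {Q} P⊆Q = sum-mono λ e → pointwise e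
      where
      pointwise : ∀ e → lookup c e on lookup P e ≤ lookup c e on lookup Q e
      pointwise e with lookup P e in eqP | lookup Q e in eqQ
      ... | false | false = ≤-refl
      ... | false | true  = c≥0 e
      ... | true  | true  = ≤-refl
      ... | true  | false with trans (sym eqQ) ([]=⇒lookup (P⊆Q (member P eqP)))
      ...   | ()

    setCost-∪-≤ : ∀ P B → setCost c (P ∪ B) ≤ setCost c P + setCost c B
    setCost-∪-≤ P B = setCost-sub c P B (P ∪ B) λ e →
      subst (λ b → lookup c e on b ≤ lookup c e on lookup P e + lookup c e on lookup B e)
        (sym (lookup-zipWith _∨_ e P B)) (pointwise (c≥0 e) (lookup P e) (lookup B e))
      where
      pointwise : ∀ {x} → 0# ≤ x → ∀ b b′ → x on (b ∨ b′) ≤ x on b + x on b′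
      pointwise {x} x≥0 true true   = x≤z+x x≥0
      pointwise {x} x≥0 true false  = ≤-reflexive (≈-sym (identityʳ x))
      pointwise {x} x≥0 false b     = ≤-reflexive (≈-sym (identityˡ _))

    -- Arcs counted repeatedly by the walk can only make it dearer, costs being nonnegative.
    setCost≤walkCost : ∀ {o n} {E : Ends n m} {u v} (W : Walk o E u v) →
                       setCost c (arcSet W) ≤ walkCost c W
    setCost≤walkCost []            = ≤-reflexive (setCost-⊥ c)
    setCost≤walkCost (step a tr W) = ≤-trans (setCost-∪-≤ ⁅ a ⁆ (arcSet W))
      (+-mono-≤ (≤-reflexive (setCost-⁅⁆ c a)) (setCost≤walkCost W))

-- Counting colours, and the programs on lists

increment : Bool → ℕ → ℕ
increment b x = if b then suc x else x

counters : ∀ {k m} → Vec (Subset m) k → Vec ℕ m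
counters []       = Vec.replicate _ 0
counters (C ∷ Cs) = Vec.zipWith increment C (counters Cs)

lookup-counters : ∀ {k m} (Cs : Vec (Subset m) k) e →
                  lookup (counters Cs) e ≡ ∣ Vec.map (λ C → lookup C e) Cs ∣
lookup-counters []       e = lookup-replicate e 0
lookup-counters (C ∷ Cs) e = trans (lookup-zipWith increment e C (counters Cs)) (count-∷ (lookup C e))
  where
  count-∷ : ∀ b → increment b (lookup (counters Cs) e) ≡ ∣ b ∷ Vec.map (λ C → lookup C e) Cs ∣
  count-∷ true  = cong suc (lookup-counters Cs e)
  count-∷ false = lookup-counters Cs e

-- Defined by matching, like the test of the program on a unary counter; `several-counters` links it
-- to `multicoloured`.
several : ℕ → Bool
several (suc (suc _)) = true
several _             = false

severalArcs : ∀ {j m} → Vec ℕ j → (Fin j → Fin m) → List (Fin m)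
severalArcs []       g = []
severalArcs (x ∷ xs) g =
  if several x then g zero ∷ severalArcs xs (g ∘ suc) else severalArcs xs (g ∘ suc)

∈-severalArcs⁺ : ∀ {j m} (xs : Vec ℕ j) (g : Fin j → Fin m) i → several (lookup xs i) ≡ true →
                 g i List.∈ severalArcs xs g
∈-severalArcs⁺ (x ∷ xs) g zero    eq rewrite eq = here refl
∈-severalArcs⁺ (x ∷ xs) g (suc i) eq with several x
... | true  = there (∈-severalArcs⁺ xs (g ∘ suc) i eq)
... | false = ∈-severalArcs⁺ xs (g ∘ suc) i eq

∈-severalArcs⁻ : ∀ {j m} (xs : Vec ℕ j) (g : Fin j → Fin m) {e} → e List.∈ severalArcs xs g →
                 ∃[ i ] g i ≡ e × several (lookup xs i) ≡ true
∈-severalArcs⁻ (x ∷ xs) g e∈ with several x in eq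
∈-severalArcs⁻ (x ∷ xs) g (here refl) | true  = zero , refl , eq
∈-severalArcs⁻ (x ∷ xs) g (there e∈)  | true  with ∈-severalArcs⁻ xs (g ∘ suc) e∈
... | i , eq′ , s = suc i , eq′ , s
∈-severalArcs⁻ (x ∷ xs) g e∈          | false with ∈-severalArcs⁻ xs (g ∘ suc) e∈
... | i , eq′ , s = suc i , eq′ , s

length-severalArcs : ∀ {j m} (xs : Vec ℕ j) (g : Fin j → Fin m) →
                     length (severalArcs xs g) ≡ ∣ Vec.map several xs ∣
length-severalArcs []       g = refl
length-severalArcs (x ∷ xs) g with several x
... | true  = cong suc (length-severalArcs xs (g ∘ suc))
... | false = length-severalArcs xs (g ∘ suc)

module ListPrograms {a ℓ₁ ℓ₂ : Level} (K : OrderedAbelianGroup a ℓ₁ ℓ₂)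
                    (Sub : Costs.Subroutine K) (o : Orientation) where

  open OrderedGroupProperties K using (Carrier; 0#; _≤?_; posPart; negative)
  open Costs K
  open Semantics K
  open Derivations Sub o

  indices : ∀ {m} → List (Fin m) → Value
  indices []       = nil
  indices (i ∷ is) = fin i ∙ indices is

  assign-returns : ∀ {b} {A : Set b} (f : A → Value) {m} i (xs : Vec A m) x →
                   Call update# (fin i ∙ vec f xs ∙ f x) (vec f (xs [ i ]≔ x)) (linear m) []
  assign-returns f i xs x =
    argument (cong (λ v → fin i ∙ v ∙ f x) (sym (vec-list f xs)))
    (result (sym (vec-list f (xs [ i ]≔ x)))
      (update-returns i _ _ (cong f (sym (lookup∘updateAt i xs)))
        λ e e≢i → cong f (sym (lookup∘updateAt′ e i e≢i xs))))

  zeros-returns : ∀ {b m} {A : Set b} (f : A → Value) (xs : Vec A m) →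
                  Call blank# (vec f xs) (vec nat (Vec.replicate m 0)) (linear m) []
  zeros-returns {m = m} f xs = argument (sym (vec-list f xs))
    (result (sym (trans (vec-list nat (Vec.replicate m 0)) (list-cong λ i → cong nat (lookup-replicate i 0))))
      (blank-returns (f ∘ lookup xs)))

  bump-returns : ∀ {m} (C : Subset m) xs →
                 Call bump# (subset C ∙ vec nat xs) (vec nat (Vec.zipWith increment C xs)) (linear m) []
  bump-returns []          []       = stop 0 (then# simple simple)
  bump-returns (true  ∷ C) (x ∷ xs) = again _ (else# simple (simple ⊕ recurse simple (bump-returns C xs)))
  bump-returns (false ∷ C) (x ∷ xs) = again _ (else# simple (simple ⊕ recurse simple (bump-returns C xs)))

  counters-returns : ∀ {b k m M} {A : Set b} (f : A → Value) (xs : Vec A m) → m ℕ.≤ M → (Cs : Vec (Subset m) k) →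
                     Call counts# (vec subset Cs ∙ vec f xs) (vec nat (counters Cs)) (suc k * (200 * suc M)) []
  counters-returns {M = M} f xs m≤M []       =
    base-case M 0 200 (then# simple (subcall 50 simple (zeros-returns f xs) (linear≤ m≤M)))
  counters-returns {k = suc k} {M = M} f xs m≤M (C ∷ Cs) = step-case M (suc k) 200 refl
    (else# simple (subcall 50 (simple ⊕ recurse simple (counters-returns f xs m≤M Cs))
      (bump-returns C (counters Cs)) (linear≤ m≤M)))

  collect-returns : ∀ {j m} (xs : Vec ℕ j) (g : Fin j → Fin m) p → (∀ i → toℕ (g i) ≡ p ℕ.+ toℕ i) →
                    Call collect# (vec nat xs ∙ nat p) (indices (severalArcs xs g)) (linear j) []
  collect-returns []       g p eq = stop 0 (then# simple simple)
  collect-returns (x ∷ xs) g p eq with x | collect-returns xs (g ∘ suc) (suc p) (λ i → trans (eq (suc i)) (ℕ.+-suc p (toℕ i)))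
  ... | zero        | D = again _ (else# simple (let# (recurse simple D) simple))
  ... | suc zero    | D = again _ (else# simple (let# (recurse simple D) simple))
  ... | suc (suc _) | D =
    result (cong (λ q → nat q ∙ indices (severalArcs xs (g ∘ suc))) (sym (trans (eq zero) (ℕ.+-identityʳ p))))
      (again _ (else# simple (let# (recurse simple D) simple)))

  single-returns : ∀ {m} (xs : Vec ℕ m) →
                   Call single# (vec nat xs) (subset (Vec.map (not ∘ several) xs)) (linear m) []
  single-returns []                 = stop 0 (then# simple simple)
  single-returns (zero ∷ xs)        = again _ (else# simple (simple ⊕ recurse simple (single-returns xs)))
  single-returns (suc zero ∷ xs)    = again _ (else# simple (simple ⊕ recurse simple (single-returns xs)))
  single-returns (suc (suc _) ∷ xs) = again _ (else# simple (simple ⊕ recurse simple (single-returns xs)))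

  pos-returns : ∀ {m} (c : Vec Carrier m) →
                Call pos# (vec num c) (vec num (Vec.map posPart c)) (linear m) []
  pos-returns []      = stop 0 (then# simple simple)
  pos-returns (x ∷ c) = result (cong (_∙ vec num (Vec.map posPart c)) (choice x))
    (again _ (else# simple (simple ⊕ recurse simple (pos-returns c))))
    where
    choice : ∀ x → if-nil-then (bool (does (0# ≤? x))) (num 0#) (num x) ≡ num (posPart x)
    choice x with does (0# ≤? x)
    ... | true  = refl
    ... | false = refl

  negs-returns : ∀ {m} (c : Vec Carrier m) →
                 Call negs# (vec num c) (subset (Vec.map negative c)) (linear m) []
  negs-returns []      = stop 0 (then# simple simple)
  negs-returns (x ∷ c) = result (cong (_∙ subset (Vec.map negative c)) (choice x))
    (again _ (else# simple (simple ⊕ recurse simple (negs-returns c))))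
    where
    choice : ∀ x → if-nil-then (bool (does (0# ≤? x))) (nil ∙ nil) nil ≡ bool (negative x)
    choice x with does (0# ≤? x)
    ... | true  = refl
    ... | false = refl

  meet-returns : ∀ {m} (p q : Subset m) →
                 Call meet# (subset p ∙ subset q) (subset (p ∩ q)) (linear m) []
  meet-returns []          []      = stop 0 (then# simple simple)
  meet-returns (true  ∷ p) (b ∷ q) = again _ (else# simple (simple ⊕ recurse simple (meet-returns p q)))
  meet-returns (false ∷ p) (b ∷ q) = again _ (else# simple (simple ⊕ recurse simple (meet-returns p q)))

  compress-returns : ∀ {b m} {A : Set b} (f : A → Value) (p : Subset m) xs →
                     Call compress# (subset p ∙ vec f xs) (vec f (compress p xs)) (linear m) []
  compress-returns f []          []       = stop 0 (then# simple simple)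
  compress-returns f (true  ∷ p) (x ∷ xs) = again _ (else# simple (let# (recurse simple (compress-returns f p xs)) simple))
  compress-returns f (false ∷ p) (x ∷ xs) = again _ (else# simple (let# (recurse simple (compress-returns f p xs)) simple))

  expand-returns : ∀ {m} (p : Subset m) q r →
                   Call expand# (subset p ∙ subset q ∙ subset r) (subset (expand p q r)) (linear m) []
  expand-returns []          []          []      = stop 0 (then# simple simple)
  expand-returns (true  ∷ p) (true  ∷ q) (b ∷ r) =
    again _ (else# simple (else# simple (simple ⊕ recurse simple (expand-returns p q r))))
  expand-returns (true  ∷ p) (false ∷ q) (b ∷ r) =
    again _ (else# simple (else# simple (simple ⊕ recurse simple (expand-returns p q r))))
  expand-returns (false ∷ p) q           (b ∷ r) =
    again _ (else# simple (then# simple (simple ⊕ recurse simple (expand-returns p q r))))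

  setCost-returns : ∀ {m} (c : Vec Carrier m) B →
                    Call setCost# (vec num c ∙ subset B) (num (setCost c B)) (linear m) []
  setCost-returns []      []          = stop 0 (then# simple simple)
  setCost-returns (x ∷ c) (true  ∷ B) = again _ (else# simple (simple ⊕ recurse simple (setCost-returns c B)))
  setCost-returns (x ∷ c) (false ∷ B) = again _ (else# simple (simple ⊕ recurse simple (setCost-returns c B)))

-- The number of colours relative to any vector of classes, for the induction on the classes.
colours : ∀ {k m} → Vec (Subset m) k → Fin m → ℕ
colours Cs e = ∣ Vec.map (λ C → lookup C e) Cs ∣

colours-tail : ∀ {k m} (C : Subset m) (Cs : Vec (Subset m) k) e → colours Cs e ℕ.≤ colours (C ∷ Cs) e
colours-tail C Cs e = ∣p∣≤∣x∷p∣ (lookup C e) (Vec.map (λ C′ → lookup C′ e) Cs)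

-- One shortest path per class for a fixed choice of multicoloured arcs

module Gather {a ℓ₁ ℓ₂ : Level} (K : OrderedAbelianGroup a ℓ₁ ℓ₂) (o : Orientation)
              (N : Costs.Network K) (negs : Subset (Costs.Network.m N)) where

  open OrderedGroupProperties K
  open Costs K
  open SetCosts K
  open Network N

  -- For `classes` this is `Feasible` by computation; the induction needs it for the tails of that
  -- vector.
  Connects : ∀ {k} → Vec (Subset m) k → Subset m → Set
  Connects Cs B = ∀ i → Σ[ W ∈ Walk o E s t ] IsPath W × arcSet W ⊆ B ∩ lookup Cs i

  -- The cost of an arc is charged to the unique class containing it; only
  -- arcs of cost zero may be used in several classes.
  record Gathers {k} (Cs : Vec (Subset m) k) (p : Subset m) (q : Vec Carrier m) (B : Subset m) : Set ℓ₂ where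
    field
      negs⊆    : negs ⊆ B
      connects : Connects Cs B
      -- `U` collects the paths of the rival `B′` in the classes treated so far. Its arcs have a
      -- colour among `Cs`; one that also lies on the path of a new class has two colours and is
      -- therefore free, so the costs add up.
      cheap    : ∀ B′ → B′ ⊆ p → Connects Cs B′ →
                 (∀ {e} → e ∈ B′ → lookup q e ≤ 0# ⊎ colours Cs e ℕ.≤ 1) →
                 ∃[ U ] U ⊆ B′ × (∀ {e} → e ∈ U → 1 ℕ.≤ colours Cs e) × setCost q B ≤ setCost q U

  data GatherResult {k} (Cs : Vec (Subset m) k) (p : Subset m) (q : Vec Carrier m) : Value → Set (a ⊔ ℓ₂) where
    gathered : ∀ B → Gathers Cs p q B → GatherResult Cs p q (nil ∙ subset B)
    blocked  : (∀ B′ → B′ ⊆ p → ¬ Connects Cs B′) → GatherResult Cs p q nil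

  query : Subset m → Vec Carrier m → Network
  query p q = network (compress p E) (compress p q) s t

  NonNegative-compress : (p : Subset m) (q : Vec Carrier m) → NonNegative q → NonNegative (compress p q)
  NonNegative-compress p q q≥0 j = subst (0# ≤_) (sym (lookup-compress p q j)) (q≥0 (embed p j))

  walkCost-compress : ∀ p (q : Vec Carrier m) (as : List (Fin ∣ p ∣)) →
                      List.foldr _+_ 0# (List.map (lookup (compress p q)) as) ≡
                      List.foldr _+_ 0# (List.map (lookup q) (List.map (embed p) as))
  walkCost-compress p q []       = refl
  walkCost-compress p q (j ∷ as) = cong₂ _+_ (lookup-compress p q j) (walkCost-compress p q as)

  restrict : ∀ p (q : Vec Carrier m) (W : Walk o E s t) → IsPath W → arcSet W ⊆ p →
             Σ[ W′ ∈ Walk o (compress p E) s t ] IsPath W′ × walkCost (compress p q) W′ ≡ walkCost q W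
  restrict p q W path W⊆p with restrictWalk p W (W⊆p ∘ ∈-⋃⁺)
  ... | W′ , eq , eq′ =
    W′ , subst (λ us → Unique (us ++ t ∷ [])) (sym eq) path ,
    trans (walkCost-compress p q (arcs W′)) (cong (List.foldr _+_ 0# ∘ List.map (lookup q)) eq′)

  Connects-tail : ∀ {k C} {Cs : Vec (Subset m) k} {B} → Connects (C ∷ Cs) B → Connects Cs B
  Connects-tail con i = con (suc i)

  module _ {k} {C : Subset m} {Cs : Vec (Subset m) k} {p : Subset m} {q : Vec Carrier m} where

    none-tail : (∀ B′ → B′ ⊆ p → ¬ Connects Cs B′) → ∀ B′ → B′ ⊆ p → ¬ Connects (C ∷ Cs) B′
    none-tail no-tail B′ B′⊆p con = no-tail B′ B′⊆p (Connects-tail {C = C} {Cs} {B′} con)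

    within-mask : ∀ {B′ x} → B′ ⊆ p → x ∈ B′ ∩ C → x ∈ p ∩ C
    within-mask {B′} B′⊆p x∈ with x∈p∩q⁻ B′ C x∈
    ... | x∈B′ , x∈C = x∈p∩q⁺ (B′⊆p x∈B′ , x∈C)

    none-head : ¬ (Σ[ W ∈ Walk o (compress (p ∩ C) E) s t ] IsPath W) →
                ∀ B′ → B′ ⊆ p → ¬ Connects (C ∷ Cs) B′
    none-head no-path B′ B′⊆p con with con zero
    ... | W , path , W⊆ with restrict (p ∩ C) q W path (within-mask B′⊆p ∘ W⊆)
    ...   | W′ , path′ , _ = no-path (W′ , path′)

    -- The new path is no dearer than the path `W₁` of the rival in class `C`, and `B` is no dearer
    -- than `U` by induction. On the left a union costs at most the sum; on the right `W₁` and `U`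
    -- share only free arcs, so their union costs at least the sum.
    Gathers-∷ : NonNegative q → ∀ {B} → Gathers Cs p q B →
                (W : Walk o (compress (p ∩ C) E) s t) → IsShortestPath o (query (p ∩ C) q) W →
                Gathers (C ∷ Cs) p q (arcSet (expandWalk (p ∩ C) W) ∪ B)
    Gathers-∷ q≥0 {B} gathers W (path , shortest) = record
      { negs⊆ = λ x∈ → x∈p∪q⁺ (inj₂ (negs⊆ x∈)) ; connects = connects′ ; cheap = cheap′ }
      where
      open Gathers gathers
      V : Walk o E s t
      V = expandWalk (p ∩ C) W
      V⊆ : arcSet V ⊆ p ∩ C
      V⊆ x∈ with ∈-expandWalk (p ∩ C) W x∈
      ... | j , _ , refl = embed-∈ (p ∩ C) j
      connects′ : Connects (C ∷ Cs) (arcSet V ∪ B)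
      connects′ zero    = V , IsPath-expandWalk (p ∩ C) W path ,
        λ x∈ → x∈p∩q⁺ (x∈p∪q⁺ (inj₁ x∈) , p∩q⊆q p C (V⊆ x∈))
      connects′ (suc i) with connects i
      ... | W₀ , path₀ , W₀⊆ = W₀ , path₀ ,
        λ x∈ → x∈p∩q⁺ (x∈p∪q⁺ (inj₂ (p∩q⊆p B _ (W₀⊆ x∈))) , p∩q⊆q B _ (W₀⊆ x∈))
      cheap′ : ∀ B′ → B′ ⊆ p → Connects (C ∷ Cs) B′ →
               (∀ {e} → e ∈ B′ → lookup q e ≤ 0# ⊎ colours (C ∷ Cs) e ℕ.≤ 1) →
               ∃[ U ] U ⊆ B′ × (∀ {e} → e ∈ U → 1 ℕ.≤ colours (C ∷ Cs) e) ×
                      setCost q (arcSet V ∪ B) ≤ setCost q U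
      cheap′ B′ B′⊆p con share
        with con zero | cheap B′ B′⊆p (Connects-tail {C = C} {Cs} {B′} con)
                          (λ e∈ → Sum.map₂ (ℕ.≤-trans (colours-tail C Cs _)) (share e∈))
      ... | W₁ , path₁ , W₁⊆ | U , U⊆ , coloured , B≤U with restrict (p ∩ C) q W₁ path₁ (within-mask B′⊆p ∘ W₁⊆)
      ...   | W₁′ , path₁′ , eq = arcSet W₁ ∪ U , subset′ , coloured′ , (begin
        setCost q (arcSet V ∪ B)          ≤⟨ setCost-∪-≤ q q≥0 (arcSet V) B ⟩
        setCost q (arcSet V) + setCost q B
          ≤⟨ +-mono-≤ (setCost≤walkCost q q≥0 V) B≤U ⟩
        walkCost q V + setCost q U
          ≡⟨ cong (_+ setCost q U) (trans (cong (List.foldr _+_ 0# ∘ List.map (lookup q)) (arcs-expandWalk (p ∩ C) W))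
               (sym (walkCost-compress (p ∩ C) q (arcs W)))) ⟩
        walkCost (compress (p ∩ C) q) W + setCost q U
          ≤⟨ +-monoˡ-≤ _ (shortest W₁′ path₁′) ⟩
        walkCost (compress (p ∩ C) q) W₁′ + setCost q U
          ≡⟨ cong (_+ setCost q U) eq ⟩
        walkCost q W₁ + setCost q U
          ≤⟨ +-monoˡ-≤ _ (walkCost≤setCost q W₁ path₁) ⟩
        setCost q (arcSet W₁) + setCost q U
          ≤⟨ setCost-∪-≥ q (arcSet W₁) U shared ⟩
        setCost q (arcSet W₁ ∪ U)         ∎)
        where
        open import Relation.Binary.Reasoning.PartialOrder poset
        head-coloured : ∀ {e} → e ∈ C → colours (C ∷ Cs) e ≡ suc (colours Cs e)
        head-coloured {e} e∈C rewrite []=⇒lookup e∈C = refl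
        subset′ : arcSet W₁ ∪ U ⊆ B′
        subset′ x∈ with x∈p∪q⁻ (arcSet W₁) U x∈
        ... | inj₁ x∈W₁ = p∩q⊆p B′ C (W₁⊆ x∈W₁)
        ... | inj₂ x∈U  = U⊆ x∈U
        coloured′ : ∀ {e} → e ∈ arcSet W₁ ∪ U → 1 ℕ.≤ colours (C ∷ Cs) e
        coloured′ {e} e∈ with x∈p∪q⁻ (arcSet W₁) U e∈
        ... | inj₁ e∈W₁ = subst (1 ℕ.≤_) (sym (head-coloured (p∩q⊆q B′ C (W₁⊆ e∈W₁)))) (s≤s z≤n)
        ... | inj₂ e∈U  = ℕ.≤-trans (coloured e∈U) (colours-tail C Cs e)
        shared : ∀ e → e ∈ arcSet W₁ → e ∈ U → lookup q e ≤ 0#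
        shared e e∈W₁ e∈U with share (U⊆ e∈U)
        ... | inj₁ q≤0 = q≤0
        ... | inj₂ ≤1  = contradiction
          (ℕ.≤-trans (s≤s (coloured e∈U)) (ℕ.≤-trans (ℕ.≤-reflexive (sym (head-coloured (p∩q⊆q B′ C (W₁⊆ e∈W₁))))) ≤1))
          λ { (s≤s ()) }

  -- The negative arcs are charged nothing, so they are no dearer than the empty `U`.
  Gathers-[] : ∀ {p q} → (∀ {e} → e ∈ negs → lookup q e ≤ 0#) → NonNegative q → Gathers [] p q negs
  Gathers-[] {p} {q} negs≤0 q≥0 = record
    { negs⊆    = λ x∈ → x∈
    ; connects = λ ()
    ; cheap    = λ B′ _ _ _ → ⊥ , (λ x∈ → contradiction x∈ ∉⊥) , (λ x∈ → contradiction x∈ ∉⊥) ,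
                 sum-mono pointwise
    }
    where
    pointwise : ∀ e → lookup q e on lookup negs e ≤ lookup q e on lookup ⊥ e
    pointwise e with lookup negs e in eq | lookup ⊥ e
    ... | false | false = ≤-refl
    ... | false | true  = q≥0 e
    ... | true  | true  = ≤-refl
    ... | true  | false = negs≤0 (member negs eq)

-- Runs of `gather#`

module GatherRuns {a ℓ₁ ℓ₂ : Level} (K : OrderedAbelianGroup a ℓ₁ ℓ₂) (o : Orientation)
                  (I : Costs.Instance K o) (negs : Subset (Costs.Instance.m I)) (S : Program) {u : ℕ}
                  (m≤u : Costs.Instance.m I ℕ.≤ u) where

  open OrderedGroupProperties K
  open Costs K
  open Semantics K
  open Instance I
  open Gather K o net negs
  open Derivations (Run S) o
  open ListPrograms K (Run S) o

  context : Value
  context = nat n ∙ ends E ∙ fin s ∙ fin t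

  Answers : Subset m → Vec Carrier m → Set (a ⊔ ℓ₂)
  Answers p q = ∃[ v ] ∃[ time ] Run S ⌜ query p q ⌝ v time × SolvesShortestPath o (query p q) v × time ℕ.≤ suc u

  record GatherRun {k} (Cs : Vec (Subset m) k) (p : Subset m) (q : Vec Carrier m) : Set (a ⊔ ℓ₂) where
    field
      {value}   : Value
      {queries} : List Value
      returned  : Call gather# (vec subset Cs ∙ subset negs ∙ (subset p ∙ vec num q) ∙ context)
                       value (suc k * (600 * suc u)) queries
      number    : length queries ≡ k
      subgraphs : All (SubgraphQuery I) queries
      correct   : GatherResult Cs p q value

  module _ {p : Subset m} {q : Vec Carrier m} (q≥0 : NonNegative q)
           (negs≤0 : ∀ {e} → e ∈ negs → lookup q e ≤ 0#) (answers : ∀ p′ → Answers p′ q) where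

    open GatherRun

    length-∷ʳ : ∀ {b} {A : Set b} (xs : List A) {x} → length (xs ++ x ∷ []) ≡ suc (length xs)
    length-∷ʳ xs = trans (length-++ xs) (ℕ.+-comm (length xs) 1)

    query-subgraph : ∀ p′ → SubgraphQuery I ⌜ query p′ q ⌝
    query-subgraph p′ =
      _ , compress p′ E , compress p′ q , s , t , compress-⊑ p′ E , NonNegative-compress p′ q q≥0 , refl

    -- The part of the run common to all outcomes, which differ only in how `gatherResult` is
    -- evaluated.
    gather-∷ : ∀ {k C qs v r w time c} {Cs : Vec (Subset m) k} {small : T (c ℕ.≤ᵇ 200)} →
               Call gather# (vec subset Cs ∙ subset negs ∙ (subset p ∙ vec num q) ∙ context)
                    r (suc k * (600 * suc u)) qs →
               Run S ⌜ query (p ∩ C) q ⌝ v time → time ℕ.≤ suc u →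
               Ev u (v ∷ subset (p ∩ C) ∷ r ∷
                     (vec subset (C ∷ Cs) ∙ subset negs ∙ (subset p ∙ vec num q) ∙ context) ∷ [])
                  gatherResult w c [] [] →
               Call gather# (vec subset (C ∷ Cs) ∙ subset negs ∙ (subset p ∙ vec num q) ∙ context)
                    w (suc (suc k) * (600 * suc u)) (qs ++ ⌜ query (p ∩ C) q ⌝ ∷ [])
    gather-∷ {k} {C} {small = small} D run t≤ R = step-case u (suc k) 600 refl
      (else# simple
      (let# (recurse simple D)
      (let# (subcall 50 simple (meet-returns p C) (linear≤ m≤u))
      (let# (ask# (simple ⊕ subcall 50 simple (compress-returns (edge K) (p ∩ C) E) (linear≤ m≤u) ⊕
                   subcall 50 simple (compress-returns num (p ∩ C) q) (linear≤ m≤u) ⊕ simple) run t≤)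
      (pad 200 {small} R)))))

    gather-run : ∀ {k} (Cs : Vec (Subset m) k) → GatherRun Cs p q
    gather-run []       = record
      { returned  = base-case u 0 600 (then# simple simple)
      ; number    = refl
      ; subgraphs = []
      ; correct   = gathered negs (Gathers-[] negs≤0 q≥0)
      }
    gather-run (C ∷ Cs)
      with record { queries = qs ; returned = D ; number = len ; subgraphs = sub ; correct = corr } ← gather-run Cs
         | _ , _ , run , solved , t≤ ← answers (p ∩ C)
      with corr | solved
    ... | blocked none-connect | _ = record
      { returned  = gather-∷ D run t≤ (then# simple simple)
      ; number    = trans (length-∷ʳ qs) (cong suc len)
      ; subgraphs = ++⁺ sub (query-subgraph (p ∩ C) ∷ [])
      ; correct   = blocked (none-tail {C = C} {Cs} {p} {q} none-connect)
      }
    ... | gathered B gathers | inj₂ (no-path , refl) = record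
      { returned  = gather-∷ D run t≤ (else# simple (then# simple simple))
      ; number    = trans (length-∷ʳ qs) (cong suc len)
      ; subgraphs = ++⁺ sub (query-subgraph (p ∩ C) ∷ [])
      ; correct   = blocked (none-head {C = C} {Cs} {p} {q} no-path)
      }
    ... | gathered B gathers | inj₁ (W , shortest , refl) = record
      { returned  = gather-∷ D run t≤ (else# simple (else# simple (simple ⊕ subcall 50 simple
          (result (cong subset (expand-arcSet (p ∩ C) W B)) (expand-returns (p ∩ C) (arcSet W) B))
          (linear≤ m≤u))))
      ; number    = trans (length-∷ʳ qs) (cong suc len)
      ; subgraphs = ++⁺ sub (query-subgraph (p ∩ C) ∷ [])
      ; correct   = gathered _ (Gathers-∷ q≥0 gathers W shortest)
      }

single-coloured : ∀ x → does (2 ℕ.≤? x) ≡ false → x ℕ.≤ 1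
single-coloured zero          _ = z≤n
single-coloured (suc zero)    _ = s≤s z≤n

-- The search over the multicoloured arcs to be bought

module Solve {a ℓ₁ ℓ₂ : Level} (K : OrderedAbelianGroup a ℓ₁ ℓ₂) (o : Orientation)
             (I : Costs.Instance K o) where

  open OrderedGroupProperties K
  open Costs K
  open Instance I
  open SetCosts K
  open import Algebra.Properties.CommutativeMonoid.Sum commutativeMonoid using (sum; ∑-distrib-+)

  multi : Subset m
  multi = multicoloured I

  negs : Subset m
  negs = Vec.map negative cost

  open Gather K o net negs

  negs-negative : ∀ {e} → e ∈ negs → negative (lookup cost e) ≡ true
  negs-negative {e} e∈ = trans (sym (lookup-map e negative cost)) ([]=⇒lookup e∈)

  -- p is the mask of the arcs allowed and q the costs charged for them: a
  -- multicoloured arc that is allowed has already been paid for.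
  record Charges (p : Subset m) (q : Vec Carrier m) : Set a where
    field
      allowed : ∀ e → lookup multi e ≡ false → e ∈ p
      charged : ∀ e → lookup q e ≡ (if lookup p e ∧ lookup multi e then 0# else posPart (lookup cost e))

  open Charges

  -- The multicoloured arcs of B are those allowed by p and some of is.
  Extends : List (Fin m) → Subset m → Subset m → Set
  Extends is p B = ∀ e → e ∈ multi → (e ∈ p → e ∈ B) × (e ∈ B → e ∈ p ⊎ e List.∈ is)

  module _ {p : Subset m} {q : Vec Carrier m} (charges : Charges p q) where

    Charges⇒NonNegative : NonNegative q
    Charges⇒NonNegative e rewrite charged charges e with lookup p e ∧ lookup multi e
    ... | true  = ≤-refl
    ... | false = posPart≥0 (lookup cost e)

    Charges⇒negs≤0 : ∀ {e} → e ∈ negs → lookup q e ≤ 0#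
    Charges⇒negs≤0 {e} e∈ rewrite charged charges e with lookup p e ∧ lookup multi e
    ... | true  = ≤-refl
    ... | false with does (0# ≤? lookup cost e) | negs-negative e∈
    ...   | false | _ = ≤-refl

    -- What the charges miss: the allowed multicoloured arcs and the arcs of
    -- negative cost, which can be bought in any case.
    uncharged : Fin m → Carrier
    uncharged e =
      if lookup p e ∧ lookup multi e then lookup cost e
      else if does (0# ≤? lookup cost e) then 0# else lookup cost e

    -- The right side pays for every allowed multicoloured arc. One that is missing from `B` is not
    -- negative, as `negs ⊆ B`, so paying for it only adds.
    cost≤charge : ∀ {B} → negs ⊆ B → setCost cost B ≤ setCost q B + sum uncharged
    cost≤charge {B} negs⊆B = begin
      setCost cost B                              ≤⟨ sum-mono pointwise ⟩
      sum (λ e → lookup q e on lookup B e + uncharged e)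
        ≈⟨ ∑-distrib-+ (λ e → lookup q e on lookup B e) uncharged ⟩
      setCost q B + sum uncharged                 ∎
      where
      open import Relation.Binary.Reasoning.PartialOrder poset
      pointwise : ∀ e → lookup cost e on lookup B e ≤ lookup q e on lookup B e + uncharged e
      pointwise e rewrite charged charges e
        with lookup p e ∧ lookup multi e | 0# ≤? lookup cost e in pos | lookup B e in inB
      ... | true  | _      | true  = ≤-reflexive (≈-sym (identityˡ _))
      ... | true  | yes 0≤ | false = ≤-trans 0≤ (≤-reflexive (≈-sym (identityˡ _)))
      ... | false | yes 0≤ | true  = ≤-reflexive (≈-sym (identityʳ _))
      ... | false | yes 0≤ | false = ≤-reflexive (≈-sym (identityˡ _))
      ... | false | no _   | true  = ≤-reflexive (≈-sym (identityˡ _))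
      ... | _     | no _   | false with trans (sym inB) ([]=⇒lookup (negs⊆B (member negs
                                          (trans (lookup-map e negative cost) (cong (not ∘ does) pos)))))
      ...   | ()

    -- Now `B` contains every allowed multicoloured arc and pays for it itself. A negative arc
    -- outside `B` only lowers the left side.
    charge≤cost : ∀ {B} → Extends [] p B → setCost q B + sum uncharged ≤ setCost cost B
    charge≤cost {B} extends = begin
      setCost q B + sum uncharged
        ≈⟨ ∑-distrib-+ (λ e → lookup q e on lookup B e) uncharged ⟨
      sum (λ e → lookup q e on lookup B e + uncharged e)  ≤⟨ sum-mono pointwise ⟩
      setCost cost B                                      ∎
      where
      open import Relation.Binary.Reasoning.PartialOrder poset
      paid : ∀ e → lookup p e ∧ lookup multi e ≡ true → lookup B e ≡ true
      paid e eq with lookup p e in inP | lookup multi e in inM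
      ... | true | true = []=⇒lookup (proj₁ (extends e (member multi inM)) (member p inP))
      pointwise : ∀ e → lookup q e on lookup B e + uncharged e ≤ lookup cost e on lookup B e
      pointwise e rewrite charged charges e
        with lookup p e ∧ lookup multi e in eq | 0# ≤? lookup cost e | lookup B e in inB
      ... | true  | _      | true  = ≤-reflexive (identityˡ _)
      ... | false | yes 0≤ | true  = ≤-reflexive (identityʳ _)
      ... | false | yes 0≤ | false = ≤-reflexive (identityˡ _)
      ... | false | no _   | true  = ≤-reflexive (identityˡ _)
      ... | false | no ¬0≤ | false = ≤-trans (≤-reflexive (identityˡ _)) (≰⇒≥ ¬0≤)
      ... | true  | _      | false with trans (sym inB) (paid e eq)
      ...   | ()

    Extends-[]⇒⊆ : ∀ {B} → Extends [] p B → B ⊆ p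
    Extends-[]⇒⊆ extends {e} e∈B with lookup multi e in eq
    ... | false = allowed charges e eq
    ... | true with proj₂ (extends e (member multi eq)) e∈B
    ...   | inj₁ e∈p = e∈p

    -- The constant `sum uncharged` is the same for both sets, so the comparison of the charges
    -- carries over to the costs. A multicoloured arc of `B′` is allowed and hence free; any other
    -- arc has at most one colour.
    gathers-optimal : ∀ {B} → Gathers classes p q B → ∀ B′ → Feasible I B′ → Extends [] p B′ →
                      setCost cost B ≤ setCost cost B′
    gathers-optimal {B} gathers B′ feasible extends
      with Gathers.cheap gathers B′ (Extends-[]⇒⊆ extends) feasible shared
      where
      shared : ∀ {e} → e ∈ B′ → lookup q e ≤ 0# ⊎ colours classes e ℕ.≤ 1
      shared {e} e∈ with lookup multi e in eq
      ... | true  = inj₁ (≤-reflexive (≈-reflexive (trans (charged charges e)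
        (cong (if_then 0# else posPart (lookup cost e))
          (cong₂ _∧_ ([]=⇒lookup (Extends-[]⇒⊆ extends e∈)) eq)))))
      ... | false = inj₂ (single-coloured _
        (trans (sym (lookup∘tabulate (λ e′ → does (2 ℕ.≤? ∣ coloursOf I e′ ∣)) e)) eq))
    ... | U , U⊆B′ , _ , B≤U = begin
      setCost cost B                  ≤⟨ cost≤charge (Gathers.negs⊆ gathers) ⟩
      setCost q B + sum uncharged     ≤⟨ +-monoˡ-≤ _ (≤-trans B≤U (setCost-mono q Charges⇒NonNegative U⊆B′)) ⟩
      setCost q B′ + sum uncharged    ≤⟨ charge≤cost extends ⟩
      setCost cost B′                 ∎
      where open import Relation.Binary.Reasoning.PartialOrder poset

  -- `B` has to undercut the sets described by `Extends`, but it may itself leave out an allowed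
  -- multicoloured arc: a cheaper feasible set is welcome.
  data SolveResult (is : List (Fin m)) (p : Subset m) : Value → Set (a ⊔ ℓ₂) where
    best       : ∀ B → Feasible I B →
                 (∀ B′ → Feasible I B′ → Extends is p B′ → setCost cost B ≤ setCost cost B′) →
                 SolveResult is p (num (setCost cost B) ∙ subset B)
    infeasible : (∀ B′ → Feasible I B′ → ¬ Extends is p B′) → SolveResult is p nil

  Charges-≔ : ∀ {p q i} → i ∈ multi → Charges p q → Charges (p [ i ]≔ true) (q [ i ]≔ 0#)
  Charges-≔ {p} {q} {i} i∈ charges = record { allowed = allowed′ ; charged = charged′ }
    where
    allowed′ : ∀ e → lookup multi e ≡ false → e ∈ p [ i ]≔ true
    allowed′ e e∉ with e ≟ i
    ... | yes refl = member _ (lookup∘updateAt i p)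
    ... | no e≢i   = member _ (trans (lookup∘updateAt′ e i e≢i p) ([]=⇒lookup (allowed charges e e∉)))
    charged′ : ∀ e → lookup (q [ i ]≔ 0#) e ≡
                (if lookup (p [ i ]≔ true) e ∧ lookup multi e then 0# else posPart (lookup cost e))
    charged′ e with e ≟ i
    ... | yes refl rewrite lookup∘updateAt i {λ _ → true} p | []=⇒lookup i∈ = lookup∘updateAt i q
    ... | no e≢i rewrite lookup∘updateAt′ e i {λ _ → true} e≢i p = trans (lookup∘updateAt′ e i e≢i q) (charged charges e)

  -- Membership of `i` in `B` decides which branch of the search covers `B`.
  Extends-∷ : ∀ {i is p B} → Extends (i ∷ is) p B → Extends is p B ⊎ Extends is (p [ i ]≔ true) B
  Extends-∷ {i} {is} {p} {B} extends with i ∈? B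
  ... | no i∉B = inj₁ λ e e∈ → proj₁ (extends e e∈) , shrink e e∈
    where
    shrink : ∀ e → e ∈ multi → e ∈ B → e ∈ p ⊎ e List.∈ is
    shrink e e∈ e∈B with proj₂ (extends e e∈) e∈B
    ... | inj₁ e∈p          = inj₁ e∈p
    ... | inj₂ (here refl)  = contradiction e∈B i∉B
    ... | inj₂ (there e∈is) = inj₂ e∈is
  ... | yes i∈B = inj₂ λ e e∈ → back e e∈ , forth e e∈
    where
    back : ∀ e → e ∈ multi → e ∈ p [ i ]≔ true → e ∈ B
    back e e∈ e∈p with e ≟ i
    ... | yes refl = i∈B
    ... | no e≢i   = proj₁ (extends e e∈)
      (member p (trans (sym (lookup∘updateAt′ e i e≢i p)) ([]=⇒lookup e∈p)))
    forth : ∀ e → e ∈ multi → e ∈ B → e ∈ p [ i ]≔ true ⊎ e List.∈ is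
    forth e e∈ e∈B with e ≟ i
    ... | yes refl = inj₁ (member _ (lookup∘updateAt i p))
    ... | no e≢i with proj₂ (extends e e∈) e∈B
    ...   | inj₁ e∈p          = inj₁ (member _ (trans (lookup∘updateAt′ e i e≢i p) ([]=⇒lookup e∈p)))
    ...   | inj₂ (here e≡i)   = contradiction e≡i e≢i
    ...   | inj₂ (there e∈is) = inj₂ e∈is

  open Semantics K using (if-nil-then)

  better : Value → Value → Value
  better v w = if-nil-then w v (if-nil-then v w (if-nil-then (⟦ leq ⟧₂ (⟦ hd ⟧₁ w) (⟦ hd ⟧₁ v)) v w))

  better-correct : ∀ {i is p v w} → SolveResult is p v → SolveResult is (p [ i ]≔ true) w →
                   SolveResult (i ∷ is) p (better v w)
  better-correct (infeasible ¬v) (infeasible ¬w) = infeasible λ B′ feasible extends →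
    Sum.[ ¬v B′ feasible , ¬w B′ feasible ] (Extends-∷ extends)
  better-correct (best B f ≤v)   (infeasible ¬w) = best B f λ B′ feasible extends →
    Sum.[ ≤v B′ feasible , (λ ext → contradiction ext (¬w B′ feasible)) ] (Extends-∷ extends)
  better-correct (infeasible ¬v) (best B f ≤w)   = best B f λ B′ feasible extends →
    Sum.[ (λ ext → contradiction ext (¬v B′ feasible)) , ≤w B′ feasible ] (Extends-∷ extends)
  better-correct (best B f ≤v)   (best C g ≤w) with setCost cost C ≤? setCost cost B
  ... | yes C≤B = best C g λ B′ feasible extends →
    Sum.[ (λ ext → ≤-trans C≤B (≤v B′ feasible ext)) , ≤w B′ feasible ] (Extends-∷ extends)
  ... | no C≰B  = best B f λ B′ feasible extends →
    Sum.[ ≤v B′ feasible , (λ ext → ≤-trans (≰⇒≥ C≰B) (≤w B′ feasible ext)) ] (Extends-∷ extends)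

-- The recurrence of a search with two recursive calls. Its shape, including `+ 0`, is that of the
-- sum of a list with two entries, so it agrees with the bound of `branch` by computation.
budget : ℕ → ℕ → ℕ
budget B zero    = B
budget B (suc j) = B ℕ.+ (budget B j ℕ.+ (budget B j ℕ.+ 0))

-- Adding `B` turns the recurrence into plain doubling. The additional `B` also pays for the
-- remainder of the main program, in `conclude`.
budget-closed : ∀ B j → B ℕ.+ budget B j ≡ 2 ^ j * (2 * B)
budget-closed B zero    = solve 1 (λ b → b :+ b := con 2 :* b :+ con 0) refl B
  where open +-*-Solver
budget-closed B (suc j) = trans
  (solve 2 (λ b r → b :+ (b :+ (r :+ (r :+ con 0))) := con 2 :* (b :+ r)) refl B (budget B j))
  (trans (cong (2 *_) (budget-closed B j)) (sym (ℕ.*-assoc 2 (2 ^ j) (2 * B))))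
  where open +-*-Solver

-- Runs of `solve#` and of the main program

module SolveRuns {a ℓ₁ ℓ₂ : Level} (K : OrderedAbelianGroup a ℓ₁ ℓ₂) (o : Orientation)
                 (I : Costs.Instance K o) (S : Program) {M u : ℕ}
                 (m≤u : Costs.Instance.m I ℕ.≤ u) (k≤M : Costs.Instance.k I ℕ.≤ M) where

  open OrderedGroupProperties K
  open Costs K
  open Semantics K
  open Instance I
  open Solve K o I
  open Gather K o net negs
  open GatherRuns K o I negs S m≤u
  open Derivations (Run S) o
  open ListPrograms K (Run S) o

  u′ : ℕ
  u′ = u ℕ.+ M * suc u

  list≤ : linear m ℕ.≤ 50 * suc u′
  list≤ = ℕ.≤-trans (linear≤ m≤u) (ℕ.*-monoʳ-≤ 50 (s≤s (ℕ.m≤m+n u _)))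

  branch : ∀ {f v w C R qs} {_ : T (C ℕ.≤ᵇ 1500)} →
           Ev u′ (v ∷ []) (lookup (library o) f) w C (R ∷ R ∷ []) qs →
           Call f v w (1500 * suc u′ ℕ.+ (R ℕ.+ (R ℕ.+ 0))) qs
  branch {C = C} {_} {_} {small} D =
    from-body D (ℕ.+-monoˡ-≤ _ (ℕ.*-monoˡ-≤ (suc u′) (ℕ.≤ᵇ⇒≤ C 1500 small)))

  record SolveRun (is : List (Fin m)) (p : Subset m) (q : Vec Carrier m) : Set (a ⊔ ℓ₂) where
    field
      {value}   : Value
      {queries} : List Value
      returned  : Call solve# (indices is ∙ (subset p ∙ vec num q) ∙ vec subset classes ∙ vec num cost ∙
                               subset negs ∙ context)
                       value (budget (1500 * suc u′) (length is)) queries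
      number    : length queries ≡ k * 2 ^ length is
      subgraphs : All (SubgraphQuery I) queries
      correct   : SolveResult is p value

  module _ (answers : ∀ p q → NonNegative q → Answers p q) where

    solve-run : ∀ is {p q} → All (_∈ multi) is → Charges p q → SolveRun is p q
    solve-run [] {p} {q} [] charges
      with gather-run (Charges⇒NonNegative charges) (Charges⇒negs≤0 charges)
             (λ p′ → answers p′ q (Charges⇒NonNegative charges)) classes
    ... | record { queries = qs ; returned = D ; number = len ; subgraphs = sub ; correct = gathered B gathers } = record
      { returned  = bounded u′ 1500
          (then# simple
          (let# (subcall 600 simple D (repeat≤ {k} {M} 600 u k≤M))
          (else# simple (subcall 50 simple (setCost-returns cost B) list≤ ⊕ simple))))
      ; number    = trans (cong length (++-identityʳ qs)) (trans len (sym (ℕ.*-identityʳ k)))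
      ; subgraphs = ++⁺ sub []
      ; correct   = best B (Gathers.connects gathers) (gathers-optimal charges gathers)
      }
    ... | record { queries = qs ; returned = D ; number = len ; subgraphs = sub ; correct = blocked none-connect } = record
      { returned  = bounded u′ 1500
          (then# simple
          (let# (subcall 600 simple D (repeat≤ {k} {M} 600 u k≤M))
          (then# simple simple)))
      ; number    = trans (cong length (++-identityʳ qs)) (trans len (sym (ℕ.*-identityʳ k)))
      ; subgraphs = ++⁺ sub []
      ; correct   = infeasible λ B′ feasible extends → none-connect B′ (Extends-[]⇒⊆ charges extends) feasible
      }
    solve-run (i ∷ is) {p} {q} (i∈ ∷ is∈) charges
      with solve-run is is∈ charges | solve-run is is∈ (Charges-≔ i∈ charges)
    ... | record { queries = qs₁ ; returned = D₁ ; number = len₁ ; subgraphs = sub₁ ; correct = correct₁ }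
        | record { queries = qs₂ ; returned = D₂ ; number = len₂ ; subgraphs = sub₂ ; correct = correct₂ } = record
      { returned  = branch
          (else# simple
          (let# (recurse simple D₁)
          (let# (recurse
                  (simple ⊕ (subcall 50 simple (assign-returns bool i p true) list≤ ⊕
                             subcall 50 simple (assign-returns num i q 0#) list≤) ⊕ simple)
                  D₂)
          simple)))
      ; number    = number′
      ; subgraphs = ++⁺ sub₁ (++⁺ sub₂ [])
      ; correct   = better-correct correct₁ correct₂
      }
      where
      open ≡-Reasoning
      number′ : length (qs₁ ++ qs₂ ++ []) ≡ k * 2 ^ length (i ∷ is)
      number′ = begin
        length (qs₁ ++ qs₂ ++ [])              ≡⟨ length-++ qs₁ ⟩
        length qs₁ ℕ.+ length (qs₂ ++ [])      ≡⟨ cong₂ ℕ._+_ len₁ (trans (cong length (++-identityʳ qs₂)) len₂) ⟩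
        k * 2 ^ length is ℕ.+ k * 2 ^ length is  ≡⟨ ℕ.*-distribˡ-+ k _ _ ⟨
        k * (2 ^ length is ℕ.+ 2 ^ length is)
          ≡⟨ cong (λ x → k * (2 ^ length is ℕ.+ x)) (ℕ.+-identityʳ _) ⟨
        k * 2 ^ length (i ∷ is)                ∎

    multiArcs : List (Fin m)
    multiArcs = severalArcs (counters classes) (λ e → e)

    several-counters : ∀ e → several (lookup (counters classes) e) ≡ lookup multi e
    several-counters e = trans (cong several (lookup-counters classes e))
      (trans (several-does (colours classes e)) (sym (lookup∘tabulate (λ e′ → does (2 ℕ.≤? ∣ coloursOf I e′ ∣)) e)))
      where
      several-does : ∀ x → several x ≡ does (2 ℕ.≤? x)
      several-does zero          = refl
      several-does (suc zero)    = refl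
      several-does (suc (suc x)) = refl

    length-multiArcs : length multiArcs ≡ ∣ multi ∣
    length-multiArcs = trans (length-severalArcs (counters classes) (λ e → e)) (cong ∣_∣ same)
      where
      same : Vec.map several (counters classes) ≡ multi
      same = trans (sym (tabulate∘lookup _)) (trans
        (tabulate-cong λ e → trans (lookup-map e several (counters classes)) (several-counters e))
        (tabulate∘lookup multi))

    multiArcs-multi : All (_∈ multi) multiArcs
    multiArcs-multi = All.tabulate λ e∈ → lemma e∈
      where
      lemma : ∀ {e} → e List.∈ multiArcs → e ∈ multi
      lemma e∈ with ∈-severalArcs⁻ (counters classes) (λ e → e) e∈
      ... | i , refl , eq = member multi (trans (sym (several-counters i)) eq)

    p₀ : Subset m
    p₀ = Vec.map (not ∘ several) (counters classes)

    q₀ : Vec Carrier m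
    q₀ = Vec.map posPart cost

    lookup-p₀ : ∀ e → lookup p₀ e ≡ not (lookup multi e)
    lookup-p₀ e = trans (lookup-map e (not ∘ several) (counters classes)) (cong not (several-counters e))

    charges₀ : Charges p₀ q₀
    charges₀ = record
      { allowed = λ e e∉ → member p₀ (trans (lookup-p₀ e) (cong not e∉)) ; charged = charged′ }
      where
      charged′ : ∀ e → lookup q₀ e ≡ (if lookup p₀ e ∧ lookup multi e then 0# else posPart (lookup cost e))
      charged′ e rewrite lookup-p₀ e with lookup multi e
      ... | true  = lookup-map e posPart cost
      ... | false = lookup-map e posPart cost

    -- At the root all multicoloured arcs are still undecided, so every set is covered and the
    -- result is optimal without restriction.
    extends₀ : ∀ B → Extends multiArcs p₀ B
    extends₀ B e e∈ =
      (λ e∈p₀ → contradiction (trans (sym ([]=⇒lookup e∈p₀)) (trans (lookup-p₀ e) (cong not ([]=⇒lookup e∈)))) λ ()) ,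
      (λ _ → inj₂ (∈-severalArcs⁺ (counters classes) (λ e → e) e (trans (several-counters e) ([]=⇒lookup e∈))))

    output : Value → Value
    output v = if-nil-then v nil (nil ∙ ⟦ tl ⟧₁ v)

    output-solves : ∀ {v} → SolveResult multiArcs p₀ v → Solves I (output v)
    output-solves (best B feasible optimal) =
      inj₁ (B , (feasible , λ B′ feasible′ → optimal B′ feasible′ (extends₀ B′)) , refl)
    output-solves (infeasible none-extend) = inj₂ ((λ (B , feasible) → none-extend B feasible (extends₀ B)) , refl)

    conclude : ∀ {Γ} {ρ : Vec Value Γ} {e v C qs} {_ : T (C ℕ.≤ᵇ 1500)} →
               Ev u′ ρ e v C (budget (1500 * suc u′) (length multiArcs) ∷ []) qs →
               ∃[ time ] Eval (Run S) (library o) ρ e v time qs × time ℕ.≤ 2 ^ ∣ multi ∣ * (2 * (1500 * suc u′))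
    conclude {C = C} {_} {small} (ev {time} D time≤) = _ , D , (begin
      time                                                   ≤⟨ time≤ ⟩
      C * suc u′ ℕ.+ (budget (1500 * suc u′) (length multiArcs) ℕ.+ 0)
        ≤⟨ ℕ.+-mono-≤ (ℕ.*-monoˡ-≤ (suc u′) (ℕ.≤ᵇ⇒≤ C 1500 small)) (ℕ.≤-reflexive (ℕ.+-identityʳ _)) ⟩
      1500 * suc u′ ℕ.+ budget (1500 * suc u′) (length multiArcs)   ≡⟨ budget-closed (1500 * suc u′) (length multiArcs) ⟩
      2 ^ length multiArcs * (2 * (1500 * suc u′))                 ≡⟨ cong (λ l → 2 ^ l * (2 * (1500 * suc u′))) length-multiArcs ⟩
      2 ^ ∣ multi ∣ * (2 * (1500 * suc u′))                        ∎)
      where open ℕ.≤-Reasoning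

    superset-runs : ∀ {B} → 2 * (1500 * suc u′) ℕ.≤ B →
                    ∃[ v ] ∃[ time ] ∃[ qs ] RunWith (Run S) (superset o) (encode I) v time qs × Solves I v ×
                    time ℕ.≤ 2 ^ ∣ multi ∣ * B ×
                    length qs ≡ k * 2 ^ ∣ multi ∣ × All (SubgraphQuery I) qs
    superset-runs B≥ with solve-run multiArcs multiArcs-multi charges₀
    ... | record { value = v ; queries = qs ; returned = D ; number = len ; subgraphs = sub ; correct = correct } =
      output v , proj₁ run , qs ++ [] , proj₁ (proj₂ run) , output-solves correct ,
      ℕ.≤-trans (proj₂ (proj₂ run)) (ℕ.*-monoʳ-≤ (2 ^ ∣ multi ∣) B≥) ,
      trans (cong length (++-identityʳ qs)) (trans len (cong (λ l → k * 2 ^ l) length-multiArcs)) , ++⁺ sub []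
      where
      run : ∃[ time ] RunWith (Run S) (superset o) (encode I) (output v) time (qs ++ []) ×
                      time ℕ.≤ 2 ^ ∣ multi ∣ * (2 * (1500 * suc u′))
      run = conclude
        (let# (subcall 200 simple (counters-returns (edge K) E m≤u classes) (repeat≤ {k} {M} 200 u k≤M))
        (let# (recurse
                (subcall 50 simple (collect-returns (counters classes) (λ e → e) 0 (λ _ → refl)) list≤ ⊕
                 (subcall 50 simple (single-returns (counters classes)) list≤ ⊕
                  subcall 50 simple (pos-returns cost) list≤) ⊕
                 simple ⊕ simple ⊕ subcall 50 simple (negs-returns cost) list≤ ⊕ simple)
                D)
        simple))

-- The factor depending on the parameter, and the polynomial bound

module _ {a ℓ₁ ℓ₂ : Level} (K : OrderedAbelianGroup a ℓ₁ ℓ₂) where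

  open Costs K
  open Semantics K

  module _ where

    open Derivations none directed

    double-returns : ∀ x → ∃[ B ] Call double# (nat x) (nat (x ℕ.+ x)) B []
    double-returns zero    = _ , from-body {u = 0} (then# simple simple) ℕ.≤-refl
    double-returns (suc x) = _ , result (cong (λ y → nat (suc y)) (sym (ℕ.+-suc x x)))
      (from-body {u = 0} (else# simple (simple ⊕ simple ⊕ recurse simple (proj₂ (double-returns x)))) ℕ.≤-refl)

    pow-returns : ∀ j → ∃[ B ] Call pow# (nat j) (nat (2 ^ j)) B []
    pow-returns zero    = _ , from-body {u = 0} (then# simple simple) ℕ.≤-refl
    pow-returns (suc j) = _ , result (cong (λ y → nat (2 ^ j ℕ.+ y)) (sym (ℕ.+-identityʳ (2 ^ j))))
      (from-body {u = 0}
        (else# simple (recurse (recurse simple (proj₂ (pow-returns j))) (proj₂ (double-returns (2 ^ j))))) ℕ.≤-refl)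

    powers-computable : Computable (2 ^_)
    powers-computable = powers , λ j → _ , call pow# (var zero) (Call.eval (proj₂ (pow-returns j)))

  size-compress : ∀ {b m} {A : Set b} (f : A → Value) p (xs : Vec A m) →
                  size (vec f (compress p xs)) ℕ.≤ size (vec f xs)
  size-compress f []          []       = ℕ.≤-refl
  size-compress f (true  ∷ p) (x ∷ xs) = s≤s (ℕ.+-monoʳ-≤ (size (f x)) (size-compress f p xs))
  size-compress f (false ∷ p) (x ∷ xs) =
    ℕ.≤-trans (size-compress f p xs) (ℕ.m≤n⇒m≤1+n (ℕ.m≤n+m _ (size (f x))))

  bound≤ : ∀ x y z → x ℕ.≤ y * z → 2 * (1500 * x) ℕ.≤ 3000 * y * z
  bound≤ x y z x≤ = begin
    2 * (1500 * x)    ≡⟨ ℕ.*-assoc 2 1500 x ⟨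
    3000 * x          ≤⟨ ℕ.*-monoʳ-≤ 3000 x≤ ⟩
    3000 * (y * z)    ≡⟨ ℕ.*-assoc 3000 y z ⟨
    3000 * y * z      ∎
    where open ℕ.≤-Reasoning

  -- For `u = M + c * M ^ d` the left side is `suc u′` by computation. The two further factors of
  -- `M` come from the loop over the classes and from the summand `M` of the unit.
  polynomial≤ : ∀ c d {M} → 1 ℕ.≤ M →
                suc (M ℕ.+ c * M ^ d) ℕ.+ M * suc (M ℕ.+ c * M ^ d) ℕ.≤ 2 * (2 ℕ.+ c) * M ^ (2 ℕ.+ d)
  polynomial≤ c d {M} M>0 = begin
    suc M * suc (M ℕ.+ c * M ^ d)       ≤⟨ ℕ.*-mono-≤ sucM≤ inner ⟩
    2 * M * ((2 ℕ.+ c) * M ^ suc d)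
      ≡⟨ solve 3 (λ m x y → con 2 :* m :* (x :* y) := con 2 :* x :* (m :* y)) refl M (2 ℕ.+ c) (M ^ suc d) ⟩
    2 * (2 ℕ.+ c) * M ^ (2 ℕ.+ d)       ∎
    where
    open ℕ.≤-Reasoning
    open +-*-Solver
    instance
      M≢0 : ℕ.NonZero M
      M≢0 = ℕ.>-nonZero M>0
    sucM≤ : suc M ℕ.≤ 2 * M
    sucM≤ = ℕ.+-mono-≤ M>0 (ℕ.m≤m+n M 0)
    M≤ : M ℕ.≤ M ^ suc d
    M≤ = ℕ.m≤m*n M (M ^ d) {{ℕ.m^n≢0 M d}}
    inner : suc (M ℕ.+ c * M ^ d) ℕ.≤ (2 ℕ.+ c) * M ^ suc d
    inner = begin
      suc M ℕ.+ c * M ^ d                      ≤⟨ ℕ.+-mono-≤ sucM≤ (ℕ.*-monoʳ-≤ c (ℕ.m≤n*m (M ^ d) M)) ⟩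
      2 * M ℕ.+ c * M ^ suc d                  ≤⟨ ℕ.+-monoˡ-≤ _ (ℕ.*-monoʳ-≤ 2 M≤) ⟩
      2 * M ^ suc d ℕ.+ c * M ^ suc d          ≡⟨ ℕ.*-distribʳ-+ (M ^ suc d) 2 c ⟨
      (2 ℕ.+ c) * M ^ suc d                    ∎

  total≤ : ∀ c d {M} → 1 ℕ.≤ M →
           2 * (1500 * (suc (M ℕ.+ c * M ^ d) ℕ.+ M * suc (M ℕ.+ c * M ^ d))) ℕ.≤
           3000 * (2 * (2 ℕ.+ c)) * M ^ (2 ℕ.+ d)
  total≤ c d {M} M>0 = bound≤ (suc (M ℕ.+ c * M ^ d) ℕ.+ M * suc (M ℕ.+ c * M ^ d))
    (2 * (2 ℕ.+ c)) (M ^ (2 ℕ.+ d)) (polynomial≤ c d M>0)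

  -- Each cost is a single leaf, so a query with changed costs is no larger than one with the
  -- original costs.
  size-nums : ∀ {m} (c c′ : Vec (OrderedAbelianGroup.Carrier K) m) → size (vec num c) ≡ size (vec num c′)
  size-nums []      []       = refl
  size-nums (x ∷ c) (y ∷ c′) = cong (2 ℕ.+_) (size-nums c c′)

  size-subnetwork : ∀ N p (q : Vec (OrderedAbelianGroup.Carrier K) (Network.m N)) → let open Network N in
                    size ⌜ network (compress p E) (compress p q) s t ⌝ ℕ.≤ size ⌜ N ⌝
  size-subnetwork N p q =
    s≤s (ℕ.+-monoʳ-≤ (size (nat n)) (s≤s (ℕ.+-mono-≤ (size-compress (edge K) p E)
      (s≤s (ℕ.+-monoˡ-≤ _ (ℕ.≤-trans (size-compress num p q) (ℕ.≤-reflexive (size-nums q cost))))))))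
    where open Network N

  module _ {o : Orientation} {S : Program} {c d : ℕ}
           (shortestPath : ∀ N → NonNegative (Network.cost N) →
                           ∃[ v ] ∃[ time ] Run S ⌜ N ⌝ v time × SolvesShortestPath o N v ×
                                            time ℕ.≤ c * size ⌜ N ⌝ ^ d)
           (I : Instance o) where

    open Instance I
    open Solve K o I using (negs)
    open Gather K o net negs using (query; NonNegative-compress)

    private
      M : ℕ
      M = inputSize I

      net≤M : size ⌜ net ⌝ ℕ.≤ M
      net≤M = ℕ.m≤n⇒m≤1+n (ℕ.m≤m+n _ _)

      -- The choice of the unit: the summand `M` pays for a pass over the arcs, the summand
      -- `c * M ^ d` for one execution of the subroutine.
      m≤u : m ℕ.≤ M ℕ.+ c * M ^ d
      m≤u = ℕ.≤-trans (ℕ.≤-trans (m≤size K net) net≤M) (ℕ.m≤m+n M _)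

      k≤M : k ℕ.≤ M
      k≤M = ℕ.m≤n⇒m≤1+n (ℕ.≤-trans (size-vec K subset classes) (ℕ.m≤n+m _ (size ⌜ net ⌝)))

    answers : ∀ p q → NonNegative q → GatherRuns.Answers K o I negs S m≤u p q
    answers p q q≥0 with shortestPath (query p q) (NonNegative-compress p q q≥0)
    ... | v , time , run , solved , time≤ = v , time , run , solved , ℕ.≤-trans time≤ (ℕ.≤-trans
      (ℕ.*-monoʳ-≤ c (ℕ.^-monoˡ-≤ d (ℕ.≤-trans (size-subnetwork net p q) net≤M)))
      (ℕ.m≤n⇒m≤1+n (ℕ.m≤n+m _ M)))

    superset-solves : ∃[ v ] ∃[ time ] ∃[ qs ] RunWith (Run S) (superset o) (encode I) v time qs × Solves I v ×
                      time ℕ.≤ 2 ^ ∣ multicoloured I ∣ * (3000 * (2 * (2 ℕ.+ c)) * M ^ (2 ℕ.+ d)) ×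
                      length qs ≡ k * 2 ^ ∣ multicoloured I ∣ × All (SubgraphQuery I) qs
    superset-solves =
      SolveRuns.superset-runs K o I S m≤u k≤M answers (total≤ c d (size>0 K (encode I)))

  superset-FPT : ∀ o S → ShortestPathAlgorithm o S → FPTAlgorithm o (superset o) S
  superset-FPT o S (c , d , shortestPath) =
    (2 ^_) , powers-computable , 3000 * (2 * (2 ℕ.+ c)) , 2 ℕ.+ d , superset-solves {c = c} {d} shortestPath

theorem3p4 : ∀ {a ℓ₁ ℓ₂ : Level} (K : OrderedAbelianGroup a ℓ₁ ℓ₂) → let open Costs K in
    (∃[ Q ] (∃[ S ] ShortestPathAlgorithm directed S)
    × (∀ S → ShortestPathAlgorithm directed S → FPTAlgorithm directed Q S))
    × (∃[ Q ] (∃[ S ] ShortestPathAlgorithm undirected S)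
    × (∀ S → ShortestPathAlgorithm undirected S → FPTAlgorithm undirected Q S))
theorem3p4 K =
  (superset directed , (shortestPathProgram directed , shortestPath-correct K directed) , superset-FPT K directed) ,
  (superset undirected , (shortestPathProgram undirected , shortestPath-correct K undirected) , superset-FPT K undirected)
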